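{- Let $A$ and $B$ be non-empty compact subsets of $\mathbb{R}$ with $|A| \ge |B|$, where $|\cdot|$ denotes Lebesgue measure. Then there are elements $b_1,b_2,b_3 \in B$ such that $$|A+\{b_1,b_2,b_3\}| \ge |A|+|B|.$$
   Context: For subsets $X,Y$ of $\mathbb{R}$, $X+Y=\{x+y : x\in X, y\in Y\}$. The elements $b_1,b_2,b_3$ are not required to be distinct. -}

module Defs where

open import Data.List.Relation.Unary.Any using (Any)
open import Data.Nat.Base as ℕ using (ℕ; zero; suc)
import Data.Nat.Properties as ℕ
open import Data.Product.Base using (∃-syntax; _×_; _,_)
open import Data.Rational.Base as ℚ using (ℚ; 0ℚ; ½)
import Data.Rational.Properties as ℚ
open import Data.Rational.Solver using (module +-*-Solver)
open import Data.Sum.Base using (_⊎_)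
open import Level using (0ℓ)
open import Relation.Binary.PropositionalEquality
  using (_≡_; refl; sym; trans; cong; subst)
open import Relation.Nullary using (¬_)
open import Relation.Unary using (Pred; _∈_; _⊆_)

------------------------------------------------------------------------
-- The real numbers, as Cauchy sequences of rationals.  Equality of reals
-- is the setoid equality _≃_, so a subset of ℝ is a predicate that
-- respects _≃_.

IsCauchy : (ℕ → ℚ) → Set
IsCauchy x = ∀ ε → 0ℚ ℚ.< ε →
  ∃[ N ] (∀ m n → N ℕ.≤ m → N ℕ.≤ n → ℚ.∣ x m ℚ.- x n ∣ ℚ.< ε)

record ℝ : Set where
  constructor mkℝ
  field
    seq    : ℕ → ℚ
    cauchy : IsCauchy seq

open ℝ public

infix 4 _≃_ _<_ _≤_

_≃_ : ℝ → ℝ → Set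
x ≃ y = ∀ ε → 0ℚ ℚ.< ε →
  ∃[ N ] (∀ n → N ℕ.≤ n → ℚ.∣ seq x n ℚ.- seq y n ∣ ℚ.< ε)

_<_ : ℝ → ℝ → Set
x < y = ∃[ ε ] (0ℚ ℚ.< ε ×
  ∃[ N ] (∀ n → N ℕ.≤ n → seq x n ℚ.+ ε ℚ.≤ seq y n))

_≤_ : ℝ → ℝ → Set
x ≤ y = ¬ (y < x)

fromℚ : ℚ → ℝ
fromℚ q = mkℝ (λ _ → q) λ ε 0<ε →
  0 , λ _ _ _ _ → subst (ℚ._< ε) (sym (cong ℚ.∣_∣ (ℚ.+-inverseʳ q))) 0<ε

0ℝ : ℝ
0ℝ = fromℚ 0ℚ

infixl 6 _+_ _-_
infix  8 -_

private
  half+half : ∀ ε → ½ ℚ.* ε ℚ.+ ½ ℚ.* ε ≡ ε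
  half+half ε = trans (sym (ℚ.*-distribʳ-+ ε ½ ½)) (ℚ.*-identityˡ ε)

  half>0 : ∀ {ε} → 0ℚ ℚ.< ε → 0ℚ ℚ.< ½ ℚ.* ε
  half>0 {ε} 0<ε = subst (ℚ._< ½ ℚ.* ε) (ℚ.*-zeroʳ ½) (ℚ.*-monoʳ-<-pos ½ 0<ε)

  interchange : ∀ a b c d →
    (a ℚ.+ b) ℚ.- (c ℚ.+ d) ≡ (a ℚ.- c) ℚ.+ (b ℚ.- d)
  interchange = solve 4
    (λ a b c d → (a :+ b) :- (c :+ d) := (a :- c) :+ (b :- d)) refl
    where open +-*-Solver

  neg-diff : ∀ a b → ℚ.- a ℚ.- ℚ.- b ≡ ℚ.- (a ℚ.- b)
  neg-diff a b = sym (ℚ.neg-distrib-+ a (ℚ.- b))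

_+_ : ℝ → ℝ → ℝ
x + y = mkℝ (λ n → seq x n ℚ.+ seq y n) λ ε 0<ε →
  let N₁ , p = cauchy x (½ ℚ.* ε) (half>0 0<ε)
      N₂ , q = cauchy y (½ ℚ.* ε) (half>0 0<ε)
  in N₁ ℕ.⊔ N₂ , λ m n N≤m N≤n →
    subst (λ t → ℚ.∣ t ∣ ℚ.< ε)
      (sym (interchange (seq x m) (seq y m) (seq x n) (seq y n)))
      (ℚ.≤-<-trans
        (ℚ.∣p+q∣≤∣p∣+∣q∣ (seq x m ℚ.- seq x n) (seq y m ℚ.- seq y n))
        (subst (_ ℚ.<_) (half+half ε)
          (ℚ.+-mono-<
            (p m n (ℕ.m⊔n≤o⇒m≤o N₁ N₂ N≤m) (ℕ.m⊔n≤o⇒m≤o N₁ N₂ N≤n))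
            (q m n (ℕ.m⊔n≤o⇒n≤o N₁ N₂ N≤m) (ℕ.m⊔n≤o⇒n≤o N₁ N₂ N≤n)))))

-_ : ℝ → ℝ
- x = mkℝ (λ n → ℚ.- seq x n) λ ε 0<ε →
  let N , p = cauchy x ε 0<ε
  in N , λ m n N≤m N≤n →
    subst (ℚ._< ε)
      (sym (trans (cong ℚ.∣_∣ (neg-diff (seq x m) (seq x n)))
                  (ℚ.∣-p∣≡∣p∣ (seq x m ℚ.- seq x n))))
      (p m n N≤m N≤n)

_-_ : ℝ → ℝ → ℝ
x - y = x + - y

------------------------------------------------------------------------
-- Subsets of ℝ

infixl 6 _⊕_

_⊕_ : Pred ℝ 0ℓ → Pred ℝ 0ℓ → Pred ℝ 0ℓ
(X ⊕ Y) z = ∃[ x ] ∃[ y ] (x ∈ X × y ∈ Y × z ≃ x + y)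

｛_,_,_｝ : ℝ → ℝ → ℝ → Pred ℝ 0ℓ
｛ a , b , c ｝ x = x ≃ a ⊎ x ≃ b ⊎ x ≃ c

Ioo : ℝ → ℝ → Pred ℝ 0ℓ
Ioo a b x = a < x × x < b

Open : Pred ℝ 0ℓ → Set
Open U = ∀ {x} → x ∈ U → ∃[ a ] ∃[ b ] (x ∈ Ioo a b × Ioo a b ⊆ U)

Compact : Pred ℝ 0ℓ → Set₁
Compact K =
  (I : Set) (U : I → Pred ℝ 0ℓ) → (∀ i → Open (U i)) →
  (∀ {x} → x ∈ K → ∃[ i ] x ∈ U i) →
  ∃[ is ] (∀ {x} → x ∈ K → Any (λ i → x ∈ U i) is)

------------------------------------------------------------------------
-- The extended half-line [0,∞].  A value v is given by the set of
-- rationals q with v < q; the empty set is ∞.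

record [0,∞] : Set₁ where
  field
    above    : Pred ℚ 0ℓ
    upward   : ∀ {p q} → p ∈ above → p ℚ.≤ q → q ∈ above
    rounded  : ∀ {q} → q ∈ above → ∃[ p ] (p ℚ.< q × p ∈ above)
    positive : ∀ {q} → q ∈ above → 0ℚ ℚ.< q

open [0,∞] public

infix  4 _≤∞_
infixl 6 _+∞_

_≤∞_ : [0,∞] → [0,∞] → Set
u ≤∞ v = above v ⊆ above u

_+∞_ : [0,∞] → [0,∞] → [0,∞]
u +∞ v = record
  { above    = λ q → ∃[ r ] ∃[ s ] (r ∈ above u × s ∈ above v × r ℚ.+ s ℚ.≤ q)
  ; upward   = λ (r , s , r∈u , s∈v , r+s≤p) p≤q →
      r , s , r∈u , s∈v , ℚ.≤-trans r+s≤p p≤q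
  ; rounded  = λ (r , s , r∈u , s∈v , r+s≤q) →
      let r′ , r′<r , r′∈u = rounded u r∈u
      in r′ ℚ.+ s , ℚ.<-≤-trans (ℚ.+-monoˡ-< s r′<r) r+s≤q ,
         r′ , s , r′∈u , s∈v , ℚ.≤-refl
  ; positive = λ (r , s , r∈u , s∈v , r+s≤q) →
      ℚ.<-≤-trans (ℚ.+-mono-< (positive u r∈u) (positive v s∈v)) r+s≤q
  }

------------------------------------------------------------------------
-- Lebesgue measure

record OpenInterval : Set where
  field
    left right : ℝ
    left≤right : left ≤ right

open OpenInterval public

⟦_⟧ : OpenInterval → Pred ℝ 0ℓ
⟦ J ⟧ = Ioo (left J) (right J)

len : OpenInterval → ℝ
len J = right J - left J

_Covers_ : (ℕ → OpenInterval) → Pred ℝ 0ℓ → Set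
J Covers X = ∀ {x} → x ∈ X → ∃[ n ] x ∈ ⟦ J n ⟧

partialSum : (ℕ → ℝ) → ℕ → ℝ
partialSum a zero    = 0ℝ
partialSum a (suc n) = partialSum a n + a n

TotalLength_≤_ : (ℕ → OpenInterval) → ℝ → Set
TotalLength J ≤ t = ∀ n → partialSum (λ i → len (J i)) n ≤ t

private
  bound-nonneg : ∀ J r → TotalLength J ≤ fromℚ r → 0ℚ ℚ.≤ r
  bound-nonneg J r bd = ℚ.≮⇒≥ λ r<0 →
    bd 0 (ℚ.- r , ℚ.neg-antimono-< r<0 ,
          0 , λ _ _ → ℚ.≤-reflexive (ℚ.+-inverseʳ r))

-- The infimum of Σₙ len (J n) over all countable covers J of X by open
-- intervals.  On Lebesgue measurable sets, in particular on compact sets,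
-- this is by definition the Lebesgue measure.
μ : Pred ℝ 0ℓ → [0,∞]
μ X = record
  { above    = λ q → ∃[ J ] (J Covers X ×
                 ∃[ r ] (r ℚ.< q × TotalLength J ≤ fromℚ r))
  ; upward   = λ (J , cov , r , r<p , bd) p≤q →
      J , cov , r , ℚ.<-≤-trans r<p p≤q , bd
  ; rounded  = λ (J , cov , r , r<q , bd) →
      let p , r<p , p<q = ℚ.<-dense r<q
      in p , p<q , J , cov , r , r<p , bd
  ; positive = λ (J , cov , r , r<q , bd) →
      ℚ.≤-<-trans (bound-nonneg J r bd) r<q
  }

{-# OPTIONS --safe #-}
module Submission where

open import Defs
open import Axiom.ExcludedMiddle using (ExcludedMiddle)
open import Data.Empty using (⊥-elim)
open import Data.Fin.Base using (Fin; zero; suc)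
open import Data.Integer.Base as ℤ using (ℤ; +_; -[1+_])
import Data.Integer.Properties as ℤ
import Algebra.Properties.AbelianGroup ℤ.+-0-abelianGroup as ℤ-Group
import Data.Integer.Tactic.RingSolver as ℤRing
open import Data.List.Base
  using (List; []; _∷_; _++_; allFin; concatMap; deduplicate; filter; length; map; take; upTo)
open import Data.List.Membership.Propositional using (find; lose) renaming (_∈_ to _∈ˡ_)
import Data.List.Membership.Propositional.Properties as ∈ˡ
import Data.List.Properties as List
open import Data.List.Relation.Unary.All as All using ([]; _∷_)
import Data.List.Relation.Unary.All.Properties as All
open import Data.List.Relation.Unary.AllPairs using ([]; _∷_)
open import Data.List.Relation.Unary.Any as Any using (here; there)
open import Data.List.Relation.Unary.Unique.DecPropositional.Properties ℤ._≟_ using (deduplicate-!)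
open import Data.List.Relation.Unary.Unique.Propositional using (Unique)
import Data.List.Relation.Unary.Unique.Propositional.Properties as Unique
open import Data.Nat.Base as ℕ using (ℕ; zero; suc; z≤n; s≤s)
import Data.Nat.Coprimality as Coprime
open import Data.Nat.ListAction using (sum)
import Data.Nat.Properties as ℕ
import Data.Nat.Tactic.RingSolver as ℕRing
open import Data.Product.Base using (∃; ∃-syntax; _×_; _,_; proj₁; proj₂)
open import Data.Rational.Base as ℚ using (ℚ; 0ℚ; 1ℚ; ½; mkℚ; *<*; *≤*)
import Data.Rational.Properties as ℚ
import Data.Rational.Unnormalised.Base as ℚᵘ
import Data.Rational.Unnormalised.Properties as ℚᵘ
open import Data.Sum.Base using (_⊎_; inj₁; inj₂; [_,_]′)
open import Function.Base using (_∘_; id; flip; case_of_)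
open import Level using (0ℓ)
open import Relation.Binary.Core using (Rel)
open import Relation.Binary.Definitions using (_Respects_)
open import Relation.Binary.PropositionalEquality
  using (_≡_; refl; sym; trans; cong; cong₂; subst; subst₂)
open import Relation.Nullary using (¬_; Dec; yes; no; ¬?; contradiction)
open import Relation.Nullary.Decidable using (dec⇒maybe)
open import Relation.Unary using (Pred; _∈_; Satisfiable)
open import Tactic.RingSolver using (solve-∀)
open import Tactic.RingSolver.Core.AlmostCommutativeRing
  using (AlmostCommutativeRing; fromCommutativeRing)

-- In ℤ the translates are by the extreme elements lo, hi of B and by an average element of B.
-- Let m = hi − lo and let s be the number of residues modulo m met by A.  Then A + {lo, hi} has at
-- least |A| + s elements, all with residues in lo + A, so for b in B \ {hi} the sums a + b with a
-- residue outside lo + A are new.  The elements of B \ {hi} are distinct modulo m, so for each a at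
-- most s of them give an old residue.  Double counting the new pairs (a , b), where
-- |A| ≥ |B| − 1, yields some b with at least |B| − 1 − s new sums, whence
-- |A + {lo, hi, b}| ≥ |A| + |B| − 1.
--
-- In ℝ this is applied, for δ = 1/(n+1), to the sets of cells [kδ, (k+1)δ) met by A and by B, the
-- latter cut down to at most one more cell than the former.  The translates are by the limits of a
-- convergent subsequence of the triples obtained.  By compactness of A, an open cover of
-- A + {b₁, b₂, b₃} has a Lebesgue number, so for small δ it contains all the grid points kδ of the
-- discrete sumset, and finitely many intervals of total length r contain at most r/δ + O(1) of them.

-- Counting in finite lists

private variable
  X Y : Set

-- The pigeonhole principle for a relation `Q`, so that partners need only exist. The partner of the
-- head is deleted from `ys`; injectivity and `Unique` show that no later element loses its own.
length-≤-injective : {Q : X → Y → Set} {xs : List X} {ys : List Y} → Unique xs →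
  (∀ {x} → x ∈ˡ xs → ∃[ y ] (y ∈ˡ ys × Q x y)) →
  (∀ {x x′ y} → x ∈ˡ xs → x′ ∈ˡ xs → Q x y → Q x′ y → x ≡ x′) →
  length xs ℕ.≤ length ys
length-≤-injective [] image injective = z≤n
length-≤-injective {Q = Q} {xs = x ∷ xs} {ys} (x∉xs ∷ uniq) image injective
  with y , y∈ys , Qxy ← image (here refl)
  with as , bs , refl ← ∈ˡ.∈-∃++ y∈ys =
  subst (suc (length xs) ℕ.≤_) (sym length-split)
    (s≤s (length-≤-injective {ys = as ++ bs} uniq image′ λ p q → injective (there p) (there q)))
  where
  length-split : length (as ++ y ∷ bs) ≡ suc (length (as ++ bs))
  length-split = trans (List.length-++ as)
    (trans (ℕ.+-suc (length as) (length bs)) (cong suc (sym (List.length-++ as))))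

  image′ : ∀ {z} → z ∈ˡ xs → ∃[ w ] (w ∈ˡ as ++ bs × Q z w)
  image′ z∈xs with w , w∈ , Qzw ← image (there z∈xs) with ∈ˡ.∈-++⁻ as w∈
  ... | inj₁ w∈as         = w , ∈ˡ.∈-++⁺ˡ w∈as , Qzw
  ... | inj₂ (there w∈bs) = w , ∈ˡ.∈-++⁺ʳ as w∈bs , Qzw
  ... | inj₂ (here refl)  = contradiction
    (injective (here refl) (there z∈xs) Qxy Qzw) (All.lookup x∉xs z∈xs)

length-≤-⊆ : {xs ys : List X} → Unique xs → (∀ {x} → x ∈ˡ xs → x ∈ˡ ys) →
  length xs ℕ.≤ length ys
length-≤-⊆ uniq sub =
  length-≤-injective {Q = _≡_} uniq (λ x∈xs → _ , sub x∈xs , refl) λ _ _ p q → trans p (sym q)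

sum-≥ : (f : X → ℕ) (e : ℕ) (xs : List X) → (∀ {x} → x ∈ˡ xs → e ℕ.≤ f x) →
  length xs ℕ.* e ℕ.≤ sum (map f xs)
sum-≥ f e []       e≤f = z≤n
sum-≥ f e (x ∷ xs) e≤f = ℕ.+-mono-≤ (e≤f (here refl)) (sum-≥ f e xs (e≤f ∘ there))

sum-≤ : (f : X → ℕ) (e : ℕ) (xs : List X) → (∀ {x} → x ∈ˡ xs → f x ℕ.≤ e) →
  sum (map f xs) ℕ.≤ length xs ℕ.* e
sum-≤ f e []       f≤e = z≤n
sum-≤ f e (x ∷ xs) f≤e = ℕ.+-mono-≤ (f≤e (here refl)) (sum-≤ f e xs (f≤e ∘ there))

module _ {P : X → Y → Set} (P? : ∀ x y → Dec (P x y)) where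

  degree : List Y → X → ℕ
  degree ys x = length (filter (P? x) ys)

  codegree : List X → Y → ℕ
  codegree xs y = length (filter (λ x → P? x y) xs)

  private
    sum-codegree-∷ : ∀ x xs ys →
      sum (map (codegree (x ∷ xs)) ys) ≡ degree ys x ℕ.+ sum (map (codegree xs) ys)
    sum-codegree-∷ x xs [] = refl
    sum-codegree-∷ x xs (y ∷ ys) with ih ← sum-codegree-∷ x xs ys | P? x y
    ... | yes _ = cong suc (trans (cong (codegree xs y ℕ.+_) ih)
      (lemma (codegree xs y) (degree ys x) _))
      where
      lemma : ∀ a b c → a ℕ.+ (b ℕ.+ c) ≡ b ℕ.+ (a ℕ.+ c)
      lemma = ℕRing.solve-∀
    ... | no _ = trans (cong (codegree xs y ℕ.+_) ih) (lemma (codegree xs y) (degree ys x) _)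
      where
      lemma : ∀ a b c → a ℕ.+ (b ℕ.+ c) ≡ b ℕ.+ (a ℕ.+ c)
      lemma = ℕRing.solve-∀

  double-counting : ∀ xs ys → sum (map (degree ys) xs) ≡ sum (map (codegree xs) ys)
  double-counting [] []       = refl
  double-counting [] (y ∷ ys) = double-counting [] ys
  double-counting (x ∷ xs) ys =
    trans (cong (degree ys x ℕ.+_) (double-counting xs ys)) (sym (sum-codegree-∷ x xs ys))

  -- Averaging: if all codegrees were below `e`, counting pairs along `ys` would give less than
  -- `length ys * e`, whereas counting along `xs` gives at least that. The element `y₀` is the
  -- witness for `e = 0` and makes the inequality strict.
  codegree-≥ : ∀ {e xs ys y₀} → y₀ ∈ˡ ys → length ys ℕ.≤ length xs →
    (∀ {x} → x ∈ˡ xs → e ℕ.≤ degree ys x) →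
    ∃[ y ] (y ∈ˡ ys × e ℕ.≤ codegree xs y)
  codegree-≥ {zero} y₀∈ys _ _ = _ , y₀∈ys , z≤n
  codegree-≥ {suc e} {xs} {ys} y₀∈ys |ys|≤|xs| e≤deg
    with Any.any? (λ y → suc e ℕ.≤? codegree xs y) ys
  ... | yes found = find found
  ... | no none = ⊥-elim (ℕ.<-irrefl refl (begin-strict
    length ys ℕ.* e             <⟨ gap ys y₀∈ys ⟩
    length ys ℕ.* suc e         ≤⟨ ℕ.*-monoˡ-≤ (suc e) |ys|≤|xs| ⟩
    length xs ℕ.* suc e         ≤⟨ sum-≥ (degree ys) (suc e) xs e≤deg ⟩
    sum (map (degree ys) xs)    ≡⟨ double-counting xs ys ⟩
    sum (map (codegree xs) ys)  ≤⟨ sum-≤ (codegree xs) e ys small ⟩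
    length ys ℕ.* e             ∎))
    where
    open ℕ.≤-Reasoning
    small : ∀ {y} → y ∈ˡ ys → codegree xs y ℕ.≤ e
    small y∈ys = ℕ.≤-pred (ℕ.≰⇒> λ le → none (lose y∈ys le))
    gap : ∀ zs {z} → z ∈ˡ zs → length zs ℕ.* e ℕ.< length zs ℕ.* suc e
    gap (_ ∷ zs) _ = ℕ.*-monoʳ-< (suc (length zs)) (ℕ.n<1+n e)

extremum : (_≼_ : Rel X 0ℓ) → (∀ x y → x ≼ y ⊎ y ≼ x) → (∀ {x y z} → x ≼ y → y ≼ z → x ≼ z) →
  ∀ {x₀} (xs : List X) → x₀ ∈ˡ xs → ∃[ m ] (m ∈ˡ xs × (∀ {x} → x ∈ˡ xs → x ≼ m))
extremum _≼_ total trans′ (x ∷ []) _ =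
  x , here refl , λ { (here refl) → [ id , id ]′ (total x x) }
extremum _≼_ total trans′ (x ∷ xs@(_ ∷ _)) _
  with m , m∈xs , xs≼m ← extremum _≼_ total trans′ xs (here refl) with total x m
... | inj₁ x≼m = m , there m∈xs , λ { (here refl) → x≼m ; (there y∈xs) → xs≼m y∈xs }
... | inj₂ m≼x = x , here refl ,
  λ { (here refl) → [ id , id ]′ (total x x) ; (there y∈xs) → trans′ (xs≼m y∈xs) m≼x }

length-filter-¬ : {P : X → Set} (P? : ∀ x → Dec (P x)) (xs : List X) →
  length (filter P? xs) ℕ.+ length (filter (¬? ∘ P?) xs) ≡ length xs
length-filter-¬ P? [] = refl
length-filter-¬ P? (x ∷ xs) with ih ← length-filter-¬ P? xs | P? x
... | yes _ = cong suc ih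
... | no _  = trans (ℕ.+-suc _ _) (cong suc ih)

i<i+k : ∀ i {k} → + 0 ℤ.< k → i ℤ.< i ℤ.+ k
i<i+k i {k} 0<k = subst (ℤ._< i ℤ.+ k) (ℤ.+-identityʳ i) (ℤ.+-monoʳ-< i 0<k)

i-1<i : ∀ i → i ℤ.- + 1 ℤ.< i
i-1<i i = subst (i ℤ.- + 1 ℤ.<_) (ℤ.+-identityʳ i) (ℤ.+-monoʳ-< i ℤ.-<+)

-- Three translates of a finite set of integers

module Discrete (em : ExcludedMiddle 0ℓ)
  {A B : List ℤ} (uniqA : Unique A) (uniqB : Unique B) (|B|≤1+|A| : length B ℕ.≤ suc (length A))
  {lo hi m : ℤ} (hi≡lo+m : hi ≡ lo ℤ.+ m) (0<m : + 0 ℤ.< m) (lo∈B : lo ∈ˡ B) (hi∈B : hi ∈ˡ B)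
  (lo≤ : ∀ {b} → b ∈ˡ B → lo ℤ.≤ b) (≤hi : ∀ {b} → b ∈ˡ B → b ℤ.≤ hi)
  where

  infix 4 _~_
  -- Congruence modulo `m`.
  record _~_ (x y : ℤ) : Set where
    constructor _,_
    field
      quotient : ℤ
      equality : x ≡ y ℤ.+ quotient ℤ.* m

  ~-sym : ∀ {x y} → x ~ y → y ~ x
  ~-sym {y = y} (j , refl) = ℤ.- j , lemma y j m
    where
    lemma : ∀ y j m → y ≡ y ℤ.+ j ℤ.* m ℤ.+ ℤ.- j ℤ.* m
    lemma = ℤRing.solve-∀

  ~-trans : ∀ {x y z} → x ~ y → y ~ z → x ~ z
  ~-trans {z = z} (j , refl) (k , refl) = j ℤ.+ k , lemma z j k m
    where
    lemma : ∀ z j k m → z ℤ.+ k ℤ.* m ℤ.+ j ℤ.* m ≡ z ℤ.+ (j ℤ.+ k) ℤ.* m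
    lemma = ℤRing.solve-∀

  ~-cancel : ∀ x x′ y {z} → x ≡ x′ ℤ.+ (y ℤ.- z) → y ~ z → x ~ x′
  ~-cancel x x′ y {z} refl (j , refl) = j , lemma x′ z j m
    where
    lemma : ∀ x′ z j m → x′ ℤ.+ (z ℤ.+ j ℤ.* m ℤ.- z) ≡ x′ ℤ.+ j ℤ.* m
    lemma = ℤRing.solve-∀

  ~-+m : ∀ x → x ℤ.+ m ~ x
  ~-+m x = + 1 , cong (λ y → x ℤ.+ y) (sym (ℤ.*-identityˡ m))

  B⁻ : List ℤ
  B⁻ = filter (λ b → ¬? (b ℤ.≟ hi)) B

  |B|≤1+|B⁻| : length B ℕ.≤ suc (length B⁻)
  |B|≤1+|B⁻| = length-≤-⊆ {ys = hi ∷ B⁻} uniqB split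
    where
    split : ∀ {b} → b ∈ˡ B → b ∈ˡ hi ∷ B⁻
    split {b} b∈B with b ℤ.≟ hi
    ... | yes b≡hi = here b≡hi
    ... | no b≢hi  = there (∈ˡ.∈-filter⁺ _ b∈B b≢hi)

  |B⁻|≤|A| : length B⁻ ℕ.≤ length A
  |B⁻|≤|A| = ℕ.≤-pred (ℕ.≤-trans 1+|B⁻|≤|B| |B|≤1+|A|)
    where
    1+|B⁻|≤|B| : suc (length B⁻) ℕ.≤ length B
    1+|B⁻|≤|B| = List.filter-notAll _ B (Any.map (λ hi≡b b≢hi → b≢hi (sym hi≡b)) hi∈B)

  -- `B⁻` lies in the window from `lo` up to but excluding `lo + m = hi`. A positive quotient would
  -- push `b` out of it, a negative one `b′`.
  B⁻-injective : ∀ {b b′} → b ∈ˡ B⁻ → b′ ∈ˡ B⁻ → b ~ b′ → b ≡ b′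
  B⁻-injective {b} {b′} b∈ b′∈ (j , b≡) = main j b≡
    where
    less : ∀ {c} → c ∈ˡ B⁻ → c ℤ.< lo ℤ.+ m
    less c∈ with c∈B , c≢hi ← ∈ˡ.∈-filter⁻ _ {xs = B} c∈ =
      subst (_ ℤ.<_) hi≡lo+m (ℤ.≤∧≢⇒< (≤hi c∈B) c≢hi)
    at-least : ∀ {c} → c ∈ˡ B⁻ → lo ℤ.≤ c
    at-least c∈ = lo≤ (proj₁ (∈ˡ.∈-filter⁻ _ {xs = B} c∈))
    main : ∀ j → b ≡ b′ ℤ.+ j ℤ.* m → b ≡ b′
    main (+ 0) b≡ = trans b≡ (ℤ.+-identityʳ b′)
    main (+ suc n) b≡ = contradiction (less b∈) (ℤ.≤⇒≯ (subst (lo ℤ.+ m ℤ.≤_) (sym b≡)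
      (ℤ.+-mono-≤ (at-least b′∈) (ℤ.≤-trans (ℤ.≤-reflexive (sym (ℤ.*-identityˡ m)))
        (ℤ.*-monoʳ-≤-nonNeg m {{ℤ.nonNegative (ℤ.<⇒≤ 0<m)}} (ℤ.+≤+ (s≤s (z≤n {n})))))))) 
    main -[1+ n ] b≡ = contradiction (less b′∈) (ℤ.≤⇒≯ (subst (lo ℤ.+ m ℤ.≤_)
      (trans (cong (ℤ._+ (+ suc n) ℤ.* m) b≡) (lemma b′ (+ suc n) m))
      (ℤ.+-mono-≤ (at-least b∈) (ℤ.≤-trans (ℤ.≤-reflexive (sym (ℤ.*-identityˡ m)))
        (ℤ.*-monoʳ-≤-nonNeg m {{ℤ.nonNegative (ℤ.<⇒≤ 0<m)}} (ℤ.+≤+ (s≤s (z≤n {n}))))))))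
      where
      lemma : ∀ b′ j m → b′ ℤ.+ ℤ.- j ℤ.* m ℤ.+ j ℤ.* m ≡ b′
      lemma = ℤRing.solve-∀

  -- Marks the largest element of `A` in a residue class. These elements form `T`, so `length T`
  -- counts the residues met by `A`, and maximality keeps `t + m` out of `A`.
  Top : ℤ → Set
  Top a = ∀ a′ → a′ ∈ˡ A → a′ ~ a → a′ ℤ.≤ a

  T : List ℤ
  T = filter (λ t → em {Top t}) A

  T⊆A : ∀ {t} → t ∈ˡ T → t ∈ˡ A
  T⊆A t∈T = proj₁ (∈ˡ.∈-filter⁻ (λ t → em {Top t}) {xs = A} t∈T)

  top : ∀ {a} → a ∈ˡ A → ∃[ t ] (t ∈ˡ T × t ~ a)
  top {a} a∈A
    with t , t∈ , max ← extremum ℤ._≤_ ℤ.≤-total ℤ.≤-trans (filter (λ x → em {x ~ a}) A)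
           (∈ˡ.∈-filter⁺ (λ x → em {x ~ a}) a∈A (+ 0 , sym (ℤ.+-identityʳ a)))
    with t∈A , t~a ← ∈ˡ.∈-filter⁻ (λ x → em {x ~ a}) {xs = A} t∈ =
    t , ∈ˡ.∈-filter⁺ (λ t → em {Top t}) t∈A
          (λ _ a′∈A a′~t → max (∈ˡ.∈-filter⁺ (λ x → em {x ~ a}) a′∈A (~-trans a′~t t~a))) , t~a

  Residue : ℤ → Set
  Residue x = ∃[ a ] (a ∈ˡ A × x ~ a)

  -- After the shift by `lo`, this says that the residue of `a + b` is outside `lo + A`.
  New : ℤ → ℤ → Set
  New a b = ¬ Residue (a ℤ.+ b ℤ.- lo)

  new? : ∀ a b → Dec (New a b)
  new? a b = ¬? em

  -- An old sum `a + b` has the residue of `lo + t` for some `t` in `T`, and for fixed `a` this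
  -- residue determines `b` in `B⁻`. So at most `length T` elements of `B⁻` fail to be new with `a`.
  B⁻-degree : ∀ {a} → a ∈ˡ A → length B⁻ ℕ.∸ length T ℕ.≤ degree new? B⁻ a
  B⁻-degree {a} a∈A = ℕ.m≤n+o⇒m∸n≤o _ (length T)
    (ℕ.≤-trans (ℕ.≤-reflexive (sym (length-filter-¬ res? B⁻)))
      (ℕ.+-monoˡ-≤ _ (length-≤-injective {Q = λ b t → a ℤ.+ b ℤ.- lo ~ t}
        (Unique.filter⁺ res? (Unique.filter⁺ _ uniqB)) image injective)))
    where
    res? : ∀ b → Dec (Residue (a ℤ.+ b ℤ.- lo))
    res? b = em
    image : ∀ {b} → b ∈ˡ filter res? B⁻ → ∃[ t ] (t ∈ˡ T × a ℤ.+ b ℤ.- lo ~ t)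
    image b∈ with _ , a′ , a′∈A , ab~a′ ← ∈ˡ.∈-filter⁻ res? {xs = B⁻} b∈
      with t , t∈T , t~a′ ← top a′∈A = t , t∈T , ~-trans ab~a′ (~-sym t~a′)
    injective : ∀ {b b′ t} → b ∈ˡ filter res? B⁻ → b′ ∈ˡ filter res? B⁻ →
      a ℤ.+ b ℤ.- lo ~ t → a ℤ.+ b′ ℤ.- lo ~ t → b ≡ b′
    injective {b} {b′} b∈ b′∈ p q =
      B⁻-injective (proj₁ (∈ˡ.∈-filter⁻ res? b∈)) (proj₁ (∈ˡ.∈-filter⁻ res? b′∈))
        (~-cancel b b′ _ (lemma a b b′ lo) (~-trans p (~-sym q)))
      where
      lemma : ∀ a b b′ lo → b ≡ b′ ℤ.+ (a ℤ.+ b ℤ.- lo ℤ.- (a ℤ.+ b′ ℤ.- lo))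
      lemma = ℤRing.solve-∀

  lo∈B⁻ : lo ∈ˡ B⁻
  lo∈B⁻ = ∈ˡ.∈-filter⁺ _ lo∈B
    (ℤ.<⇒≢ (subst (lo ℤ.<_) (sym hi≡lo+m) (i<i+k lo 0<m)))

  abstract
    middle : ∃[ b ] (b ∈ˡ B⁻ × length B⁻ ℕ.∸ length T ℕ.≤ codegree new? A b)
    middle = codegree-≥ new? lo∈B⁻ |B⁻|≤|A| B⁻-degree

  b : ℤ
  b = proj₁ middle

  b∈B : b ∈ˡ B
  b∈B = proj₁ (∈ˡ.∈-filter⁻ _ (proj₁ (proj₂ middle)))

  translate : ℤ → List ℤ → List ℤ
  translate c = map (ℤ._+ c)

  N : List ℤ
  N = filter (λ a → new? a b) A

  D : List ℤ
  D = translate lo A ++ (translate hi T ++ translate b N)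

  -- The blocks are disjoint: `a + lo = t + hi` would put `t + m` into `A`, above the maximal `t`;
  -- and the first two blocks have residues in `lo + A`, while the third avoids these.
  uniqD : Unique D
  uniqD = Unique.++⁺ (translate-unique lo uniqA)
    (Unique.++⁺ (translate-unique hi (Unique.filter⁺ (λ t → em {Top t}) uniqA))
      (translate-unique b (Unique.filter⁺ (λ a → new? a b) uniqA)) hi-b)
    λ (p , q) → [ (λ q → lo-hi (p , q)) , (λ q → lo-b (p , q)) ]′ (∈ˡ.∈-++⁻ (translate hi T) q)
    where
    translate-unique : ∀ c {xs} → Unique xs → Unique (translate c xs)
    translate-unique c = Unique.map⁺ (ℤ-Group.∙-cancelʳ c _ _)

    sub-hi : ∀ t → t ℤ.+ hi ℤ.- lo ≡ t ℤ.+ m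
    sub-hi t = trans (cong (λ h → t ℤ.+ h ℤ.- lo) hi≡lo+m) (lemma t lo m)
      where
      lemma : ∀ t lo m → t ℤ.+ (lo ℤ.+ m) ℤ.- lo ≡ t ℤ.+ m
      lemma = ℤRing.solve-∀

    sub-lo : ∀ a lo → a ℤ.+ lo ℤ.- lo ≡ a
    sub-lo = ℤRing.solve-∀

    lo-hi : ∀ {x} → ¬ (x ∈ˡ translate lo A × x ∈ˡ translate hi T)
    lo-hi (p , q)
      with a , a∈A , refl ← ∈ˡ.∈-map⁻ _ p
      with t , t∈T , eq ← ∈ˡ.∈-map⁻ _ q
      with t∈A , isTop ← ∈ˡ.∈-filter⁻ (λ t → em {Top t}) {xs = A} t∈T =
      ℤ.<-irrefl refl (ℤ.<-≤-trans (i<i+k t 0<m)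
        (subst (ℤ._≤ t) a≡t+m (isTop a a∈A (subst (_~ t) (sym a≡t+m) (~-+m t)))))
      where
      a≡t+m : a ≡ t ℤ.+ m
      a≡t+m = trans (sym (sub-lo a lo)) (trans (cong (ℤ._- lo) eq) (sub-hi t))

    lo-b : ∀ {x} → ¬ (x ∈ˡ translate lo A × x ∈ˡ translate b N)
    lo-b (p , q)
      with a , a∈A , refl ← ∈ˡ.∈-map⁻ _ p
      with a′ , a′∈N , eq ← ∈ˡ.∈-map⁻ _ q
      with a′∈A , isNew ← ∈ˡ.∈-filter⁻ (λ a → new? a b) {xs = A} a′∈N =
      isNew (a , a∈A , + 0 ,
        trans (cong (ℤ._- lo) (sym eq)) (trans (sub-lo a lo) (sym (ℤ.+-identityʳ a))))

    hi-b : ∀ {x} → ¬ (x ∈ˡ translate hi T × x ∈ˡ translate b N)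
    hi-b (p , q)
      with t , t∈T , refl ← ∈ˡ.∈-map⁻ _ p
      with a′ , a′∈N , eq ← ∈ˡ.∈-map⁻ _ q
      with a′∈A , isNew ← ∈ˡ.∈-filter⁻ (λ a → new? a b) {xs = A} a′∈N =
      isNew (t , T⊆A t∈T , subst (_~ t)
        (trans (sym (sub-hi t)) (cong (ℤ._- lo) eq)) (~-+m t))

  D-sums : ∀ {d} → d ∈ˡ D → ∃[ a ] (a ∈ˡ A × (d ≡ a ℤ.+ lo ⊎ d ≡ a ℤ.+ hi ⊎ d ≡ a ℤ.+ b))
  D-sums d∈D with ∈ˡ.∈-++⁻ (translate lo A) d∈D
  ... | inj₁ p with a , a∈A , eq ← ∈ˡ.∈-map⁻ _ p = a , a∈A , inj₁ eq
  ... | inj₂ p with ∈ˡ.∈-++⁻ (translate hi T) p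
  ...   | inj₁ q with t , t∈T , eq ← ∈ˡ.∈-map⁻ _ q = t , T⊆A t∈T , inj₂ (inj₁ eq)
  ...   | inj₂ q with a , a∈N , eq ← ∈ˡ.∈-map⁻ _ q =
    a , proj₁ (∈ˡ.∈-filter⁻ (λ a → new? a b) a∈N) , inj₂ (inj₂ eq)

  |D| : length A ℕ.+ length B ℕ.≤ suc (length D)
  |D| = begin
    length A ℕ.+ length B                      ≤⟨ ℕ.+-monoʳ-≤ (length A) |B|≤1+|B⁻| ⟩
    length A ℕ.+ suc (length B⁻)               ≡⟨ ℕ.+-suc _ _ ⟩
    -- Truncated subtraction is harmless: `length B⁻` is at most `length T` plus
    -- `length B⁻ ∸ length T` in every case, and `middle` bounds the latter by `length N`.
    suc (length A ℕ.+ length B⁻)               ≤⟨ s≤s (ℕ.+-monoʳ-≤ (length A)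
      (ℕ.≤-trans (ℕ.m≤n+m∸n _ (length T)) (ℕ.+-monoʳ-≤ (length T) (proj₂ (proj₂ middle))))) ⟩
    suc (length A ℕ.+ (length T ℕ.+ length N)) ≡⟨ cong suc (sym length-D) ⟩
    suc (length D)                             ∎
    where
    open ℕ.≤-Reasoning
    length-D : length D ≡ length A ℕ.+ (length T ℕ.+ length N)
    length-D = trans (List.length-++ (translate lo A)) (cong₂ ℕ._+_ (List.length-map _ A)
      (trans (List.length-++ (translate hi T))
        (cong₂ ℕ._+_ (List.length-map _ T) (List.length-map _ N))))

discrete : ExcludedMiddle 0ℓ → ∀ {A B b₀} → Unique A → Unique B → b₀ ∈ˡ B →
  length B ℕ.≤ suc (length A) →
  ∃[ b₁ ] ∃[ b₂ ] ∃[ b₃ ] ∃[ D ] (b₁ ∈ˡ B × b₂ ∈ˡ B × b₃ ∈ˡ B × Unique D ×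
    (∀ {d} → d ∈ˡ D → ∃[ a ] (a ∈ˡ A × (d ≡ a ℤ.+ b₁ ⊎ d ≡ a ℤ.+ b₂ ⊎ d ≡ a ℤ.+ b₃))) ×
    length A ℕ.+ length B ℕ.≤ suc (length D))
discrete em {A} {B} uniqA uniqB b₀∈B |B|≤1+|A|
  with lo , lo∈B , lo≤ ← extremum ℤ._≥_ (flip ℤ.≤-total) (flip ℤ.≤-trans) B b₀∈B
  with hi , hi∈B , ≤hi ← extremum ℤ._≤_ ℤ.≤-total ℤ.≤-trans B b₀∈B
  with lo ℤ.<? hi
... | yes lo<hi = lo , hi , b , D , lo∈B , hi∈B , b∈B , uniqD , D-sums , |D|
  where
  lemma : ∀ hi lo → hi ≡ lo ℤ.+ (hi ℤ.- lo)
  lemma = ℤRing.solve-∀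
  open Discrete em uniqA uniqB |B|≤1+|A| (lemma hi lo)
      (subst (ℤ._< hi ℤ.- lo) (ℤ.+-inverseʳ lo) (ℤ.+-monoˡ-< (ℤ.- lo) lo<hi))
      lo∈B hi∈B lo≤ ≤hi
    using (b; D; b∈B; uniqD; D-sums; |D|)
-- The extremes coincide, so the modulus would be zero; but `B` is then one point, and a single
-- translate of `A` has `length A + length B − 1` elements.
... | no lo≮hi = lo , lo , lo , map (ℤ._+ lo) A , lo∈B , lo∈B , lo∈B ,
  Unique.map⁺ (ℤ-Group.∙-cancelʳ lo _ _) uniqA ,
  (λ d∈ → let a , a∈A , eq = ∈ˡ.∈-map⁻ _ d∈ in a , a∈A , inj₁ eq) ,
  subst (λ n → length A ℕ.+ length B ℕ.≤ suc n) (sym (List.length-map _ A))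
    (ℕ.≤-trans (ℕ.+-monoʳ-≤ (length A) |B|≤1) (ℕ.≤-reflexive (ℕ.+-comm _ 1)))
  where
  |B|≤1 : length B ℕ.≤ 1
  |B|≤1 = length-≤-⊆ {ys = lo ∷ []} uniqB
    λ b∈B → here (ℤ.≤-antisym (ℤ.≤-trans (≤hi b∈B) (ℤ.≮⇒≥ lo≮hi)) (lo≤ b∈B))

-- Rational bounds of real numbers

ℚ-ring : AlmostCommutativeRing 0ℓ 0ℓ
ℚ-ring = fromCommutativeRing ℚ.+-*-commutativeRing (λ q → dec⇒maybe (0ℚ ℚ.≟ q))

-- Linear arithmetic over ℚ: p ≤ q is a sum of hypotheses, and the equation is a ring identity.
linear-≤ : ∀ {p q r s} → p ℚ.≤ q → q ℚ.+ r ≡ p ℚ.+ s → r ℚ.≤ s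
linear-≤ p≤q eq = ℚ.≮⇒≥ λ s<r → ℚ.<⇒≢ (ℚ.+-mono-≤-< p≤q s<r) (sym eq)

linear-< : ∀ {p q r s} → p ℚ.< q → q ℚ.+ r ≡ p ℚ.+ s → r ℚ.< s
linear-< p<q eq = ℚ.≰⇒> λ s≤r → ℚ.<⇒≢ (ℚ.+-mono-<-≤ p<q s≤r) (sym eq)

p<p+ε : ∀ {p ε} → 0ℚ ℚ.< ε → p ℚ.< p ℚ.+ ε
p<p+ε {p} {ε} 0<ε = linear-< 0<ε (lemma p ε)
  where
  lemma : ∀ p ε → ε ℚ.+ p ≡ 0ℚ ℚ.+ (p ℚ.+ ε)
  lemma = solve-∀ ℚ-ring

0<q-p : ∀ {p q} → p ℚ.< q → 0ℚ ℚ.< q ℚ.- p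
0<q-p {p} {q} p<q = linear-< p<q (lemma p q)
  where
  lemma : ∀ p q → q ℚ.+ 0ℚ ≡ p ℚ.+ (q ℚ.- p)
  lemma = solve-∀ ℚ-ring

half : ∀ {ε} → 0ℚ ℚ.< ε → ∃[ η ] (0ℚ ℚ.< η × η ℚ.+ η ≡ ε)
half {ε} 0<ε = ½ ℚ.* ε , subst (ℚ._< ½ ℚ.* ε) (ℚ.*-zeroʳ ½) (ℚ.*-monoʳ-<-pos ½ 0<ε) ,
  trans (sym (ℚ.*-distribʳ-+ ε ½ ½)) (ℚ.*-identityˡ ε)

∣p∣<q⇒p<q : ∀ {p q} → ℚ.∣ p ∣ ℚ.< q → p ℚ.< q
∣p∣<q⇒p<q {p} ∣p∣<q = ℚ.≤-<-trans p≤∣p∣ ∣p∣<q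
  where
  p≤∣p∣ : p ℚ.≤ ℚ.∣ p ∣
  p≤∣p∣ with ℚ.≤-total 0ℚ p
  ... | inj₁ 0≤p = ℚ.≤-reflexive (sym (ℚ.0≤p⇒∣p∣≡p 0≤p))
  ... | inj₂ p≤0 = ℚ.≤-trans p≤0 (ℚ.0≤∣p∣ p)

-- Rational bounds of a real number; records, so that unification does not unfold the arithmetic of ℝ.
infix 4 _◂_ _▸_

record _◂_ (p : ℚ) (x : ℝ) : Set where
  constructor lower
  field lower⁻¹ : fromℚ p < x

record _▸_ (x : ℝ) (q : ℚ) : Set where
  constructor upper
  field upper⁻¹ : x < fromℚ q

fromℚ-mono-◂ : ∀ {p q} → p ℚ.< q → p ◂ fromℚ q
fromℚ-mono-◂ {p} {q} p<q = lower (q ℚ.- p , 0<q-p p<q , 0 , λ _ _ → ℚ.≤-reflexive (lemma p q))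
  where
  lemma : ∀ p q → p ℚ.+ (q ℚ.- p) ≡ q
  lemma = solve-∀ ℚ-ring

fromℚ-cancel-◂ : ∀ {p q} → p ◂ fromℚ q → p ℚ.< q
fromℚ-cancel-◂ (lower (ε , 0<ε , N , p<q)) = ℚ.<-≤-trans (p<p+ε 0<ε) (p<q N ℕ.≤-refl)

◂-▸⇒< : ∀ {p x q} → p ◂ x → x ▸ q → p ℚ.< q
◂-▸⇒< (lower (ε , 0<ε , M , p<x)) (upper (η , 0<η , N , x<q)) =
  ℚ.<-≤-trans (p<p+ε 0<ε) (ℚ.≤-trans (p<x (M ℕ.⊔ N) (ℕ.m≤m⊔n M N))
    (ℚ.≤-trans (ℚ.<⇒≤ (p<p+ε 0<η)) (x<q (M ℕ.⊔ N) (ℕ.m≤n⊔m M N))))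

▸-◂⇒< : ∀ {x p y} → x ▸ p → p ◂ y → x < y
▸-◂⇒< (upper (ε , 0<ε , M , x<p)) (lower (η , 0<η , N , p<y)) =
  ε , 0<ε , M ℕ.⊔ N , λ n M⊔N≤n →
  ℚ.≤-trans (x<p n (ℕ.m⊔n≤o⇒m≤o M N M⊔N≤n))
    (ℚ.≤-trans (ℚ.<⇒≤ (p<p+ε 0<η)) (p<y n (ℕ.m⊔n≤o⇒n≤o M N M⊔N≤n)))

≤-◂-trans : ∀ {p q x} → p ℚ.≤ q → q ◂ x → p ◂ x
≤-◂-trans p≤q (lower (ε , 0<ε , N , q<x)) =
  lower (ε , 0<ε , N , λ n N≤n → ℚ.≤-trans (ℚ.+-monoˡ-≤ ε p≤q) (q<x n N≤n))

▸-≤-trans : ∀ {x p q} → x ▸ p → p ℚ.≤ q → x ▸ q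
▸-≤-trans (upper (ε , 0<ε , N , x<p)) p≤q =
  upper (ε , 0<ε , N , λ n N≤n → ℚ.≤-trans (x<p n N≤n) p≤q)

private
  interchange : ∀ a b c d → a ℚ.+ b ℚ.+ (c ℚ.+ d) ≡ a ℚ.+ c ℚ.+ (b ℚ.+ d)
  interchange = solve-∀ ℚ-ring

+-mono-◂ : ∀ {p q x y} → p ◂ x → q ◂ y → p ℚ.+ q ◂ x + y
+-mono-◂ {p} {q} {x} {y} (lower (ε , 0<ε , M , p<x)) (lower (η , 0<η , N , q<y)) =
  lower (ε ℚ.+ η , ℚ.+-mono-< 0<ε 0<η , M ℕ.⊔ N , λ n M⊔N≤n →
    subst (ℚ._≤ seq x n ℚ.+ seq y n) (interchange p ε q η)
      (ℚ.+-mono-≤ (p<x n (ℕ.m⊔n≤o⇒m≤o M N M⊔N≤n)) (q<y n (ℕ.m⊔n≤o⇒n≤o M N M⊔N≤n))))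

+-mono-▸ : ∀ {x y p q} → x ▸ p → y ▸ q → x + y ▸ p ℚ.+ q
+-mono-▸ {x} {y} {p} {q} (upper (ε , 0<ε , M , x<p)) (upper (η , 0<η , N , y<q)) =
  upper (ε ℚ.+ η , ℚ.+-mono-< 0<ε 0<η , M ℕ.⊔ N , λ n M⊔N≤n →
    subst (ℚ._≤ p ℚ.+ q) (interchange (seq x n) ε (seq y n) η)
      (ℚ.+-mono-≤ (x<p n (ℕ.m⊔n≤o⇒m≤o M N M⊔N≤n)) (y<q n (ℕ.m⊔n≤o⇒n≤o M N M⊔N≤n))))

neg-▸ : ∀ {x q} → x ▸ q → ℚ.- q ◂ - x
neg-▸ {x} {q} (upper (ε , 0<ε , N , x<q)) =
  lower (ε , 0<ε , N , λ n N≤n → linear-≤ (x<q n N≤n) (lemma (seq x n) ε q))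
  where
  lemma : ∀ x ε q → q ℚ.+ (ℚ.- q ℚ.+ ε) ≡ x ℚ.+ ε ℚ.+ ℚ.- x
  lemma = solve-∀ ℚ-ring

≃-refl : ∀ x → x ≃ x
≃-refl x ε 0<ε = 0 , λ n _ →
  subst (ℚ._< ε) (sym (cong ℚ.∣_∣ (ℚ.+-inverseʳ (seq x n)))) 0<ε

approximate : ∀ x {ε} → 0ℚ ℚ.< ε → ∃[ p ] (p ◂ x × x ▸ p ℚ.+ ε)
approximate x {ε} 0<ε =
  -- With `θ = ε/4`, the terms from `N` on are within `θ` of `seq x N`. The window reaches `2θ` to
  -- either side, which leaves a gap `θ` at each end to witness the strict inequalities.
  let η , 0<η , η+η≡ε = half 0<ε
      θ , 0<θ , θ+θ≡η = half 0<η
      N , near        = cauchy x θ 0<θ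
  in seq x N ℚ.- η ,
     lower (θ , 0<θ , N , λ n N≤n → linear-≤ (ℚ.<⇒≤ (∣p∣<q⇒p<q (near N n ℕ.≤-refl N≤n)))
        (trans (cong (λ e → θ ℚ.+ (seq x N ℚ.- e ℚ.+ θ)) (sym θ+θ≡η))
          (below (seq x N) (seq x n) θ))) ,
     upper (θ , 0<θ , N , λ n N≤n → linear-≤ (ℚ.<⇒≤ (∣p∣<q⇒p<q (near n N N≤n ℕ.≤-refl)))
        (trans (beyond (seq x N) (seq x n) θ) (cong₂ (λ e f →
            seq x n ℚ.- seq x N ℚ.+ (seq x N ℚ.- e ℚ.+ f)) θ+θ≡η
              (trans (cong₂ ℚ._+_ θ+θ≡η θ+θ≡η) η+η≡ε))))
  where
  below : ∀ a b θ → θ ℚ.+ (a ℚ.- (θ ℚ.+ θ) ℚ.+ θ) ≡ a ℚ.- b ℚ.+ b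
  below = solve-∀ ℚ-ring
  beyond : ∀ a b θ → θ ℚ.+ (b ℚ.+ θ) ≡ b ℚ.- a ℚ.+ (a ℚ.- (θ ℚ.+ θ) ℚ.+ (θ ℚ.+ θ ℚ.+ (θ ℚ.+ θ)))
  beyond = solve-∀ ℚ-ring

-- The gap `ε` of `x < y` serves as the precision: if `s < x < s + ε`, then `s + ε` is below `x + ε`
-- and hence below `y`.
between : ∀ x y → x < y → ∃[ p ] (x ▸ p × p ◂ y)
between x y (ε , 0<ε , M , x<y) =
  let s , lower (η , 0<η , N , s<x) , x▸s+ε = approximate x 0<ε
  in s ℚ.+ ε , x▸s+ε , lower (η , 0<η , M ℕ.⊔ N , λ n M⊔N≤n →
    linear-≤ (ℚ.+-mono-≤ (x<y n (ℕ.m⊔n≤o⇒m≤o M N M⊔N≤n)) (s<x n (ℕ.m⊔n≤o⇒n≤o M N M⊔N≤n)))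
      (lemma (seq x n) (seq y n) s ε η))
  where
  lemma : ∀ x y s ε η → y ℚ.+ x ℚ.+ (s ℚ.+ ε ℚ.+ η) ≡ x ℚ.+ ε ℚ.+ (s ℚ.+ η) ℚ.+ y
  lemma = solve-∀ ℚ-ring

-- Approximating `x` to precision `q − p` leaves a comparison of rationals. This turns a negated
-- bound into a positive one at the cost of arbitrarily small slack, as in `¬▸⇒◂`.
cotransitive : ∀ {p q} → p ℚ.< q → ∀ x → p ◂ x ⊎ x ▸ q
cotransitive {p} {q} p<q x =
  let s , s◂x , x▸s+ε = approximate x (0<q-p p<q)
  in [ (λ p≤s → inj₁ (≤-◂-trans p≤s s◂x)) ,
       (λ s≤p → inj₂ (▸-≤-trans x▸s+ε (linear-≤ s≤p (lemma p q s)))) ]′ (ℚ.≤-total p s)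
  where
  lemma : ∀ p q s → p ℚ.+ (s ℚ.+ (q ℚ.- p)) ≡ s ℚ.+ q
  lemma = solve-∀ ℚ-ring

¬▸⇒◂ : ∀ {x p q} → p ℚ.< q → ¬ (x ▸ q) → p ◂ x
¬▸⇒◂ {x} p<q ¬x▸q = [ id , (λ x▸q → contradiction x▸q ¬x▸q) ]′ (cotransitive p<q x)

-- A rational `r` between `p` and `x + y` leaves `r − p` to be spent, half each, on the errors of
-- approximating `x` and `y`.
below-sum : ∀ x y {p} → p ◂ x + y → ∃[ s ] ∃[ t ] (s ◂ x × t ◂ y × p ℚ.< s ℚ.+ t)
below-sum x y {p} (lower p<x+y) =
  let r , upper p<r , r◂x+y = between (fromℚ p) (x + y) p<x+y
      ε , 0<ε , ε+ε≡r-p     = half (0<q-p (fromℚ-cancel-◂ {p} (lower p<r)))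
      s , s◂x , x▸s+ε       = approximate x 0<ε
      t , t◂y , y▸t+ε       = approximate y 0<ε
  in s , t , s◂x , t◂y ,
     linear-< (◂-▸⇒< r◂x+y (+-mono-▸ x▸s+ε y▸t+ε))
       (trans (lemma s t p ε)
         (trans (cong (λ e → s ℚ.+ t ℚ.+ (e ℚ.+ p)) ε+ε≡r-p) (lemma′ s t p r)))
  where
  lemma : ∀ s t p ε → s ℚ.+ ε ℚ.+ (t ℚ.+ ε) ℚ.+ p ≡ s ℚ.+ t ℚ.+ (ε ℚ.+ ε ℚ.+ p)
  lemma = solve-∀ ℚ-ring
  lemma′ : ∀ s t p r → s ℚ.+ t ℚ.+ (r ℚ.- p ℚ.+ p) ≡ r ℚ.+ (s ℚ.+ t)
  lemma′ = solve-∀ ℚ-ring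

above-sum : ∀ x y {p} → x + y ▸ p → ∃[ s ] ∃[ t ] (x ▸ s × y ▸ t × s ℚ.+ t ℚ.< p)
above-sum x y {p} (upper x+y<p) =
  let r , x+y▸r , lower r<p = between (x + y) (fromℚ p) x+y<p
      ε , 0<ε , ε+ε≡p-r     = half (0<q-p (fromℚ-cancel-◂ {r} (lower r<p)))
      s , s◂x , x▸s+ε       = approximate x 0<ε
      t , t◂y , y▸t+ε       = approximate y 0<ε
  in s ℚ.+ ε , t ℚ.+ ε , x▸s+ε , y▸t+ε ,
     linear-< (◂-▸⇒< (+-mono-◂ s◂x t◂y) x+y▸r)
       (trans (lemma s t r ε)
         (trans (cong (λ e → s ℚ.+ t ℚ.+ (e ℚ.+ r)) ε+ε≡p-r) (lemma′ s t p r)))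
  where
  lemma : ∀ s t r ε → r ℚ.+ (s ℚ.+ ε ℚ.+ (t ℚ.+ ε)) ≡ s ℚ.+ t ℚ.+ (ε ℚ.+ ε ℚ.+ r)
  lemma = solve-∀ ℚ-ring
  lemma′ : ∀ s t p r → s ℚ.+ t ℚ.+ (p ℚ.- r ℚ.+ r) ≡ s ℚ.+ t ℚ.+ p
  lemma′ = solve-∀ ℚ-ring

-- Integers, unit fractions and the Archimedean property in ℚ

fromℤ : ℤ → ℚ
fromℤ k = mkℚ k 0 (Coprime.sym (Coprime.1-coprimeTo ℤ.∣ k ∣))

fromℤ-+ : ∀ k l → fromℤ (k ℤ.+ l) ≡ fromℤ k ℚ.+ fromℤ l
fromℤ-+ k l = ℚ.toℚᵘ-injective
  (ℚᵘ.≃-trans (ℚᵘ.*≡* (lemma k l)) (ℚᵘ.≃-sym (ℚ.toℚᵘ-homo-+ (fromℤ k) (fromℤ l))))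
  where
  lemma : ∀ k l → (k ℤ.+ l) ℤ.* + 1 ≡ (k ℤ.* + 1 ℤ.+ l ℤ.* + 1) ℤ.* + 1
  lemma = ℤRing.solve-∀

fromℤ-suc : ∀ n → fromℤ (+ suc n) ≡ 1ℚ ℚ.+ fromℤ (+ n)
fromℤ-suc n = trans (cong fromℤ (ℤ.pos-+ 1 n)) (fromℤ-+ (+ 1) (+ n))

fromℤ-mono-≤ : ∀ {k l} → k ℤ.≤ l → fromℤ k ℚ.≤ fromℤ l
fromℤ-mono-≤ k≤l = *≤* (ℤ.*-monoʳ-≤-nonNeg (+ 1) k≤l)

fromℤ-mono-< : ∀ {k l} → k ℤ.< l → fromℤ k ℚ.< fromℤ l
fromℤ-mono-< k<l = *<* (ℤ.*-monoʳ-<-pos (+ 1) k<l)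

archimedean : ∀ p → ∃[ M ] p ℚ.< fromℤ (+ M)
archimedean (mkℚ (+ n) d _) = suc n , *<* (subst₂ ℤ._<_ (ℤ.pos-* n 1) (ℤ.pos-* (suc n) (suc d))
  (ℤ.+<+ (ℕ.<-≤-trans (s≤s (ℕ.≤-reflexive (ℕ.*-identityʳ n))) (ℕ.m≤m*n (suc n) (suc d)))))
archimedean (mkℚ -[1+ n ] d _) = 0 , *<* ℤ.-<+

-- The fraction 1/(n+1), as `mkℚ` stores the denominator minus one. Given in lowest terms, it
-- involves no gcd, so its order reduces to integer inequalities.
1/1+ : ℕ → ℚ
1/1+ n = mkℚ (+ 1) n (Coprime.1-coprimeTo (suc n))

0<1/1+ : ∀ n → 0ℚ ℚ.< 1/1+ n
0<1/1+ n = *<* (ℤ.+<+ (s≤s z≤n))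

1/1+-anti-≤ : ∀ {m n} → m ℕ.≤ n → 1/1+ n ℚ.≤ 1/1+ m
1/1+-anti-≤ m≤n = *≤* (ℤ.*-monoˡ-≤-nonNeg (+ 1) (ℤ.+≤+ (s≤s m≤n)))

1/1+-archimedean : ∀ {ε} → 0ℚ ℚ.< ε → ∃[ n ] 1/1+ n ℚ.< ε
1/1+-archimedean {mkℚ (+ 0) d _}       (*<* (ℤ.+<+ ()))
1/1+-archimedean {mkℚ (+ suc a) d _} _ = suc d , *<* (subst₂ ℤ._<_ (ℤ.pos-* 1 (suc d))
  (ℤ.pos-* (suc a) (2 ℕ.+ d)) (ℤ.+<+ (ℕ.<-≤-trans (s≤s (ℕ.≤-reflexive (ℕ.*-identityˡ (suc d))))
    (ℕ.m≤n*m (2 ℕ.+ d) (suc a)))))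
1/1+-archimedean { mkℚ -[1+ _ ] d _}   (*<* ())

1+n*1/1+n≡1 : ∀ n → fromℤ (+ suc n) ℚ.* 1/1+ n ≡ 1ℚ
1+n*1/1+n≡1 n = ℚ.toℚᵘ-injective
  (ℚᵘ.≃-trans (ℚ.toℚᵘ-homo-* (fromℤ (+ suc n)) (1/1+ n)) (ℚᵘ.*≡* (lemma (+ suc n))))
  where
  lemma : ∀ k → k ℤ.* + 1 ℤ.* + 1 ≡ + 1 ℤ.* (+ 1 ℤ.* k)
  lemma = ℤRing.solve-∀

fraction : ∀ n {ε} → 0ℚ ℚ.< ε → ∃[ η ] (0ℚ ℚ.< η × fromℤ (+ suc n) ℚ.* η ≡ ε)
fraction n {ε} 0<ε = 1/1+ n ℚ.* ε ,
  subst (ℚ._< 1/1+ n ℚ.* ε) (ℚ.*-zeroʳ (1/1+ n))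
    (ℚ.*-monoʳ-<-pos (1/1+ n) {{ℚ.positive (0<1/1+ n)}} 0<ε) ,
  trans (sym (ℚ.*-assoc (fromℤ (+ suc n)) (1/1+ n) ε))
    (trans (cong (ℚ._* ε) (1+n*1/1+n≡1 n)) (ℚ.*-identityˡ ε))

-- Discretisation

-- Indices from an arbitrary set `I` can carry the data that justify their intervals, and finitely
-- many of these data come back. Cluster points and Lebesgue numbers are extracted in this way.
compact-ℚ : ∀ {K} → Compact K → ∀ {I : Set} (p q : I → ℚ) →
  (∀ {x} → x ∈ K → ∃[ i ] (p i ◂ x × x ▸ q i)) →
  ∃[ is ] (∀ {x} → x ∈ K → ∃[ i ] (i ∈ˡ is × p i ◂ x × x ▸ q i))
compact-ℚ compact {I} p q cover =
  let is , finite = compact I (λ i → Ioo (fromℚ (p i)) (fromℚ (q i)))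
        (λ i x∈ → fromℚ (p i) , fromℚ (q i) , x∈ , id)
        (λ x∈K → let i , lower p<x , upper x<q = cover x∈K in i , p<x , x<q)
  in is , λ x∈K → let i , i∈is , p<x , x<q = find (finite x∈K) in i , i∈is , lower p<x , upper x<q

module Grid (δ : ℚ) (0<δ : 0ℚ ℚ.< δ) where

  private instance
    δ-positive : ℚ.Positive δ
    δ-positive = ℚ.positive 0<δ

    δ-nonZero : ℚ.NonZero δ
    δ-nonZero = ℚ.>-nonZero 0<δ

    δ-nonNegative : ℚ.NonNegative δ
    δ-nonNegative = ℚ.nonNegative (ℚ.<⇒≤ 0<δ)

  abstract
    grid : ℤ → ℚ
    grid k = fromℤ k ℚ.* δ

    grid-def : ∀ k → grid k ≡ fromℤ k ℚ.* δ
    grid-def k = refl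

    grid-+ : ∀ k l → grid (k ℤ.+ l) ≡ grid k ℚ.+ grid l
    grid-+ k l = trans (cong (ℚ._* δ) (fromℤ-+ k l)) (ℚ.*-distribʳ-+ δ (fromℤ k) (fromℤ l))

    grid-1 : grid (+ 1) ≡ δ
    grid-1 = ℚ.*-identityˡ δ

    grid-0 : grid (+ 0) ≡ 0ℚ
    grid-0 = ℚ.*-zeroˡ δ

    grid-mono-≤ : ∀ {k l} → k ℤ.≤ l → grid k ℚ.≤ grid l
    grid-mono-≤ k≤l = ℚ.*-monoʳ-≤-nonNeg δ (fromℤ-mono-≤ k≤l)

    grid-mono-< : ∀ {k l} → k ℤ.< l → grid k ℚ.< grid l
    grid-mono-< k<l = ℚ.*-monoˡ-<-pos δ (fromℤ-mono-< k<l)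

    grid-unbounded : ∀ p → ∃[ M ] p ℚ.< grid (+ M)
    grid-unbounded p =
      let M , p/δ<M = archimedean (p ℚ.* ℚ.1/ δ)
      in M , subst (ℚ._< fromℤ (+ M) ℚ.* δ)
        (trans (ℚ.*-assoc p (ℚ.1/ δ) δ)
          (trans (cong (p ℚ.*_) (ℚ.*-inverseˡ δ)) (ℚ.*-identityʳ p)))
        (ℚ.*-monoˡ-<-pos δ p/δ<M)

  grid-cancel-< : ∀ {k l} → grid k ℚ.< grid l → k ℤ.< l
  grid-cancel-< gk<gl = ℤ.≰⇒> λ l≤k → ℚ.<-irrefl refl (ℚ.<-≤-trans gk<gl (grid-mono-≤ l≤k))

  grid-suc : ∀ k → grid (k ℤ.+ + 1) ≡ grid k ℚ.+ δ
  grid-suc k = trans (grid-+ k (+ 1)) (cong (grid k ℚ.+_) grid-1)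

  -- The half-open cell [kδ, (k+1)δ). Its closed left end is the negation of a strict bound, so
  -- strict lower bounds on `x` come only with slack, by `cell-◂`.
  record Cell (k : ℤ) (x : ℝ) : Set where
    constructor cell
    field
      above-left  : ¬ (x ▸ grid k)
      below-right : x ▸ grid (k ℤ.+ + 1)

  open Cell public

  cell-◂ : ∀ {k p x} → Cell k x → p ℚ.< grid k → p ◂ x
  cell-◂ c p<k = ¬▸⇒◂ p<k (above-left c)

  cell-< : ∀ {k q x} → Cell k x → x ▸ q → grid k ℚ.< q
  cell-< c x▸q = ℚ.≰⇒> λ q≤k → above-left c (▸-≤-trans x▸q q≤k)

  abstract
    -- Some `−Mδ` and `Nδ` enclose `x`. Descending from the upper end, excluded middle finds the
    -- first grid point that is not above `x`.
    floor : ExcludedMiddle 0ℓ → ∀ x → ∃[ k ] Cell k x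
    floor em x =
      let p , p◂x , x▸p+1 = approximate x {1ℚ} (*<* (ℤ.+<+ (s≤s z≤n)))
          M , -p<M        = grid-unbounded (ℚ.- p)
          N , p+1<N       = grid-unbounded (p ℚ.+ 1ℚ)
      in search (ℤ.- (+ M)) (M ℕ.+ N)
           (λ x▸-M → ℚ.<-asym (◂-▸⇒< p◂x x▸-M) (linear-< -p<M (lower-eq p M)))
           (▸-≤-trans x▸p+1 (ℚ.≤-trans (ℚ.<⇒≤ p+1<N) (ℚ.≤-reflexive (cong grid (end M N)))))
      where
      lower-eq : ∀ p M → grid (+ M) ℚ.+ grid (ℤ.- (+ M)) ≡ ℚ.- p ℚ.+ p
      lower-eq p M = trans (sym (grid-+ (+ M) (ℤ.- (+ M))))
        (trans (cong grid (ℤ.+-inverseʳ (+ M))) (trans grid-0 (sym (ℚ.+-inverseˡ p))))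

      end : ∀ M N → + N ≡ ℤ.- (+ M) ℤ.+ + (M ℕ.+ N)
      end M N = trans (lemma (+ M) (+ N)) (cong (λ n → ℤ.- (+ M) ℤ.+ n) (sym (ℤ.pos-+ M N)))
        where
        lemma : ∀ m n → n ≡ ℤ.- m ℤ.+ (m ℤ.+ n)
        lemma = ℤRing.solve-∀

      search : ∀ b n → ¬ (x ▸ grid b) → x ▸ grid (b ℤ.+ + n) → ∃[ k ] Cell k x
      search b zero ¬x▸b x▸b = contradiction (subst (λ c → x ▸ grid c) (ℤ.+-identityʳ b) x▸b) ¬x▸b
      search b (suc n) ¬x▸b x▸b+1+n = case em {x ▸ grid (b ℤ.+ + n)} of λ
        { (yes x▸b+n) → search b n ¬x▸b x▸b+n
        ; (no ¬x▸b+n) → b ℤ.+ + n ,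
            cell ¬x▸b+n (subst (λ c → x ▸ grid c) (step b n) x▸b+1+n)
        }
        where
        step : ∀ b n → b ℤ.+ + suc n ≡ b ℤ.+ + n ℤ.+ + 1
        step b n = trans (cong (λ n → b ℤ.+ + n) (ℕ.+-comm 1 n))
          (trans (cong (λ i → b ℤ.+ i) (ℤ.pos-+ n 1)) (sym (ℤ.+-assoc b (+ n) (+ 1))))

  record Discretisation (X : Pred ℝ 0ℓ) : Set where
    field
      cells    : List ℤ
      unique   : Unique cells
      occupied : ∀ {k} → k ∈ˡ cells → ∃[ x ] (x ∈ X × Cell k x)
      covers   : ∀ {x} → x ∈ X → ∃[ k ] (k ∈ˡ cells × Cell k x)

  abstract
    -- Cells are not open, so compactness is applied to the intervals from (i-1)δ to (i+1)δ. Each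
    -- meets only the cells `i − 1` and `i`, which leaves finitely many candidates to be filtered
    -- for occupied ones.
    discretise : ExcludedMiddle 0ℓ → ∀ {X} → Compact X → Discretisation X
    discretise em {X} compact = record
      { cells    = deduplicate ℤ._≟_ (filter occupied? candidates)
      ; unique   = deduplicate-! _
      ; occupied = λ k∈ →
          proj₂ (∈ˡ.∈-filter⁻ occupied? {xs = candidates} (∈ˡ.∈-deduplicate⁻ ℤ._≟_ _ k∈))
      ; covers   = λ {x} x∈X → let k , c = floor em x in
          k , ∈ˡ.∈-deduplicate⁺ ℤ._≟_ (∈ˡ.∈-filter⁺ occupied? (candidate x∈X c) (x , x∈X , c)) , c
      }
      where
      occupied? : ∀ k → Dec (∃[ x ] (x ∈ X × Cell k x))
      occupied? k = em

      finite : ∃[ is ] (∀ {x} → x ∈ X →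
        ∃[ i ] (i ∈ˡ is × grid (i ℤ.- + 1) ◂ x × x ▸ grid (i ℤ.+ + 1)))
      finite = compact-ℚ compact (λ i → grid (i ℤ.- + 1)) (λ i → grid (i ℤ.+ + 1))
        λ {x} _ → let k , c = floor em x in
          k , cell-◂ c (grid-mono-< (i-1<i k)) , below-right c

      candidates : List ℤ
      candidates = concatMap (λ i → i ℤ.- + 1 ∷ i ∷ []) (proj₁ finite)

      adjacent : ∀ {i k} → i ℤ.- + 1 ℤ.< k ℤ.+ + 1 → k ℤ.< i ℤ.+ + 1 → k ≡ i ℤ.- + 1 ⊎ k ≡ i
      adjacent {i} {k} i-1<k+1 k<i+1 = case k ℤ.≟ i of λ
        { (yes k≡i) → inj₂ k≡i
        ; (no k≢i)  → inj₁ (ℤ.≤-antisym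
            (pred-≤ (ℤ.≤∧≢⇒< (<+1⇒≤ k<i+1) k≢i)) (<+1⇒≤ i-1<k+1))
        }
        where
        <+1⇒≤ : ∀ {i j} → i ℤ.< j ℤ.+ + 1 → i ℤ.≤ j
        <+1⇒≤ {i} {j} i<j+1 = subst (i ℤ.≤_) (lemma j) (ℤ.i<j⇒i≤pred[j] i<j+1)
          where
          lemma : ∀ j → -[1+ 0 ] ℤ.+ (j ℤ.+ + 1) ≡ j
          lemma = ℤRing.solve-∀
        pred-≤ : ∀ {i j} → i ℤ.< j → i ℤ.≤ j ℤ.- + 1
        pred-≤ {i} {j} i<j = subst (i ℤ.≤_) (ℤ.+-comm (ℤ.- (+ 1)) j) (ℤ.i<j⇒i≤pred[j] i<j)

      candidate : ∀ {x k} → x ∈ X → Cell k x → k ∈ˡ candidates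
      candidate {x} x∈X c =
        let i , i∈is , i-1◂x , x▸i+1 = proj₂ finite x∈X
        in ∈ˡ.∈-concatMap⁺ (λ i → i ℤ.- + 1 ∷ i ∷ []) (lose i∈is
             ([ here , there ∘ here ]′
               (adjacent (grid-cancel-< (◂-▸⇒< i-1◂x (below-right c)))
                 (grid-cancel-< (cell-< c x▸i+1)))))

-- Upper bounds for the outer measure from finite covers

partialSum-suc : ∀ a n m →
  seq (partialSum a (suc n)) m ≡ seq (a 0) m ℚ.+ seq (partialSum (a ∘ suc) n) m
partialSum-suc a zero    m = ℚ.+-comm 0ℚ (seq (a 0) m)
partialSum-suc a (suc n) m = trans (cong (ℚ._+ seq (a (suc n)) m) (partialSum-suc a n m))
  (ℚ.+-assoc (seq (a 0) m) _ _)

-- `partialSum` grows at its end, whereas a cover read off a list starts with the head; so the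
-- induction on `l` peels off the first term by `partialSum-suc`. It concerns the rational terms at
-- one fixed index `m`.
partialSum-≤ : ∀ {w} → 0ℚ ℚ.≤ w → ∀ l (a : ℕ → ℝ) m →
  (∀ i → i ℕ.< l → seq (a i) m ℚ.≤ w) → (∀ i → l ℕ.≤ i → seq (a i) m ℚ.≤ 0ℚ) →
  ∀ n → seq (partialSum a n) m ℚ.≤ fromℤ (+ l) ℚ.* w
partialSum-≤ {w} 0≤w zero a m short null = go
  where
  go : ∀ n → seq (partialSum a n) m ℚ.≤ fromℤ (+ 0) ℚ.* w
  go zero    = ℚ.≤-reflexive (sym (ℚ.*-zeroˡ w))
  go (suc n) = subst (seq (partialSum a n) m ℚ.+ seq (a n) m ℚ.≤_) (ℚ.+-identityʳ _)
    (ℚ.+-mono-≤ (go n) (null n z≤n))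
partialSum-≤ {w} 0≤w (suc l) a m short null n =
  subst (seq (partialSum a n) m ℚ.≤_) (sym step) (go n)
  where
  step : fromℤ (+ suc l) ℚ.* w ≡ w ℚ.+ fromℤ (+ l) ℚ.* w
  step = trans (cong (ℚ._* w) (fromℤ-suc l))
    (trans (ℚ.*-distribʳ-+ w 1ℚ (fromℤ (+ l)))
      (cong (ℚ._+ fromℤ (+ l) ℚ.* w) (ℚ.*-identityˡ w)))
  tail : ∀ n → seq (partialSum (a ∘ suc) n) m ℚ.≤ fromℤ (+ l) ℚ.* w
  tail = partialSum-≤ 0≤w l (a ∘ suc) m (λ i i<l → short (suc i) (s≤s i<l))
    (λ i l≤i → null (suc i) (s≤s l≤i))
  go : ∀ n → seq (partialSum a n) m ℚ.≤ w ℚ.+ fromℤ (+ l) ℚ.* w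
  go zero    = ℚ.+-mono-≤ 0≤w (tail 0)
  go (suc n) = subst (ℚ._≤ w ℚ.+ fromℤ (+ l) ℚ.* w) (sym (partialSum-suc a n m))
    (ℚ.+-mono-≤ (short 0 (s≤s z≤n)) (tail n))

∈-μ-finite : ∀ {X : Pred ℝ 0ℓ} {w q} → 0ℚ ℚ.≤ w → (ps : List ℚ) →
  (∀ {x} → x ∈ X → ∃[ p ] (p ∈ˡ ps × p ◂ x × x ▸ p ℚ.+ w)) →
  fromℤ (+ length ps) ℚ.* w ℚ.< q → q ∈ above (μ X)
∈-μ-finite {X} {w} 0≤w ps cover |ps|*w<q =
  Js ps , (λ x∈X → let p , p∈ps , p◂x , x▸p+w = cover x∈X in Js-covers p∈ps p◂x x▸p+w) ,
  fromℤ (+ length ps) ℚ.* w , |ps|*w<q ,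
  λ n (ε , 0<ε , N , bound) → ℚ.<-irrefl refl
    (ℚ.<-≤-trans (p<p+ε 0<ε) (ℚ.≤-trans (bound N ℕ.≤-refl)
      (partialSum-≤ 0≤w (length ps) (λ i → len (Js ps i)) N (Js-short ps N) (Js-null ps N) n)))
  where
  interval : ℚ → ∀ {w} → 0ℚ ℚ.≤ w → OpenInterval
  interval p {w} 0≤w = record
    { left       = fromℚ p
    ; right      = fromℚ (p ℚ.+ w)
    ; left≤right = λ p+w<p → ℚ.<-irrefl refl (ℚ.<-≤-trans (fromℚ-cancel-◂ {p ℚ.+ w} (lower p+w<p))
        (subst (ℚ._≤ p ℚ.+ w) (ℚ.+-identityʳ p) (ℚ.+-monoʳ-≤ p 0≤w)))
    }

  Js : List ℚ → ℕ → OpenInterval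
  -- Past the end of the list come empty intervals of length zero, which leave the total unchanged.
  Js []       _       = interval 0ℚ ℚ.≤-refl
  Js (p ∷ ps) zero    = interval p 0≤w
  Js (p ∷ ps) (suc n) = Js ps n

  Js-covers : ∀ {ps p x} → p ∈ˡ ps → p ◂ x → x ▸ p ℚ.+ w → ∃[ n ] x ∈ ⟦ Js ps n ⟧
  Js-covers (here refl) (lower p<x) (upper x<p+w) = 0 , p<x , x<p+w
  Js-covers (there p∈ps) p◂x x▸p+w = let n , x∈ = Js-covers p∈ps p◂x x▸p+w in suc n , x∈

  p+w-p≡w : ∀ p w → p ℚ.+ w ℚ.- p ≡ w
  p+w-p≡w = solve-∀ ℚ-ring

  Js-short : ∀ ps m i → i ℕ.< length ps → seq (len (Js ps i)) m ℚ.≤ w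
  Js-short (p ∷ ps) m zero    _         = ℚ.≤-reflexive (p+w-p≡w p w)
  Js-short (p ∷ ps) m (suc i) (s≤s i<n) = Js-short ps m i i<n

  Js-null : ∀ ps m i → length ps ℕ.≤ i → seq (len (Js ps i)) m ℚ.≤ 0ℚ
  Js-null []       m i       _         = ℚ.≤-reflexive (p+w-p≡w 0ℚ 0ℚ)
  Js-null (p ∷ ps) m (suc i) (s≤s n≤i) = Js-null ps m i n≤i

module _ {δ : ℚ} (0<δ : 0ℚ ℚ.< δ) where
  open Grid δ 0<δ

  -- Each cell contains its left end, so it is widened by `τ` to the left to fit into an open
  -- interval. With `τ = δ/(n+1)`, widening `n` cells costs less than `δ`, the one extra cell in the
  -- count.
  discretisation-∈-μ : ∀ {X} (D : Discretisation X) →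
    grid (+ suc (length (Discretisation.cells D))) ∈ above (μ X)
  discretisation-∈-μ {X} D =
    let τ , 0<τ , 1+n*τ≡δ = fraction n 0<δ
    in ∈-μ-finite {w = τ ℚ.+ δ} (ℚ.<⇒≤ (ℚ.+-mono-< 0<τ 0<δ)) (map (λ k → grid k ℚ.- τ) cells)
      (λ x∈X → let k , k∈ , c = covers x∈X in
        grid k ℚ.- τ , ∈ˡ.∈-map⁺ _ k∈ ,
        cell-◂ c (linear-< 0<τ (left-eq (grid k) τ)) ,
        ▸-≤-trans (below-right c) (ℚ.≤-reflexive
          (trans (grid-suc k) (right-eq (grid k) τ δ))))
      (linear-< 0<τ (trans (cong (λ l → τ ℚ.+ fromℤ (+ l) ℚ.* (τ ℚ.+ δ)) (List.length-map _ cells))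
        (trans (total (fromℤ (+ n)) τ δ)
          (trans (cong₂ ℚ._+_ (trans (cong (ℚ._* τ) (sym (fromℤ-suc n))) 1+n*τ≡δ) refl)
            (trans (rest (fromℤ (+ n)) δ)
              (cong (0ℚ ℚ.+_)
                (trans (cong (ℚ._* δ) (sym (fromℤ-suc n))) (sym (grid-def (+ suc n))))))))))
    where
    open Discretisation D
    n = length cells
    left-eq : ∀ g τ → τ ℚ.+ (g ℚ.- τ) ≡ 0ℚ ℚ.+ g
    left-eq = solve-∀ ℚ-ring
    right-eq : ∀ g τ δ → g ℚ.+ δ ≡ g ℚ.- τ ℚ.+ (τ ℚ.+ δ)
    right-eq = solve-∀ ℚ-ring
    total : ∀ n τ δ → τ ℚ.+ n ℚ.* (τ ℚ.+ δ) ≡ (1ℚ ℚ.+ n) ℚ.* τ ℚ.+ n ℚ.* δ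
    total = solve-∀ ℚ-ring
    rest : ∀ n δ → δ ℚ.+ n ℚ.* δ ≡ 0ℚ ℚ.+ (1ℚ ℚ.+ n) ℚ.* δ
    rest = solve-∀ ℚ-ring

-- Limits and Lebesgue numbers

bounded : ∀ {I : Set} (f : I → ℕ) is → ∃[ M ] (∀ {i} → i ∈ˡ is → f i ℕ.≤ M)
bounded f []       = 0 , λ ()
bounded f (i ∷ is) = let M , f≤M = bounded f is in
  f i ℕ.⊔ M , λ { (here refl) → ℕ.m≤m⊔n (f i) M ; (there j∈is) → ℕ.m≤n⇒m≤o⊔n (f i) (f≤M j∈is) }

-- Closeness is expressed by a common rational window of length `ε`, in the form in which `◂` and
-- `▸` combine.
Near : ℚ → ℝ → ℝ → Set
Near ε y b = ∃[ p ] (p ◂ y × y ▸ p ℚ.+ ε × p ◂ b × b ▸ p ℚ.+ ε)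

module _ (em : ExcludedMiddle 0ℓ) {B : Pred ℝ 0ℓ} (compact : Compact B)
  (y : ℕ → ℝ) (y∈B : ∀ n → y n ∈ B) where

  private
    Hits : ℚ → ℚ → ℕ → Set
    Hits p q n = ∃[ m ] (n ℕ.≤ m × p ◂ y m × y m ▸ q)

    Isolated : ℝ → Set
    Isolated b = ∃[ p ] ∃[ q ] ∃[ n ] (¬ Hits p q n × p ◂ b × b ▸ q)

  -- Otherwise every point of `B` has a rational neighbourhood that the sequence avoids from some
  -- index on. Finitely many of them cover `B`, and at the largest of their indices `y` would have
  -- nowhere to be.
  cluster-point : ∃[ b ] (b ∈ B × ∀ {p q} n → p ◂ b → b ▸ q → Hits p q n)
  cluster-point = case em {∃[ b ] (b ∈ B × ¬ Isolated b)} of λ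
    { (yes (b , b∈B , ¬isolated)) → b , b∈B , λ {p} {q} n p◂b b▸q →
        case em {Hits p q n} of λ
          { (yes hits) → hits
          ; (no ¬hits) → contradiction (p , q , n , ¬hits , p◂b , b▸q) ¬isolated
          }
    ; (no none) →
        let is , finite = compact-ℚ compact
              {I = ∃[ p ] ∃[ q ] ∃[ n ] (¬ Hits p q n)} proj₁ (proj₁ ∘ proj₂)
              (λ {b} b∈B → case em {Isolated b} of λ
                { (yes (p , q , n , ¬hits , p◂b , b▸q)) → (p , q , n , ¬hits) , p◂b , b▸q
                ; (no ¬isolated) → contradiction (b , b∈B , ¬isolated) none
                })
            M , n≤M = bounded (proj₁ ∘ proj₂ ∘ proj₂) is
            (p , q , n , ¬hits) , i∈is , p◂y , y▸q = finite (y∈B M)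
        in contradiction (M , n≤M i∈is , p◂y , y▸q) ¬hits
    }

  convergent-subsequence : ∃[ b ] (b ∈ B ×
    ∃[ φ ] ((∀ k → k ℕ.≤ φ k) × (∀ k → Near (1/1+ k) (y (φ k)) b)))
  convergent-subsequence =
    let b , b∈B , hits = cluster-point
        near k = approximate b (0<1/1+ k)
        hit k = hits k (proj₁ (proj₂ (near k))) (proj₂ (proj₂ (near k)))
    in b , b∈B , (λ k → proj₁ (hit k)) , (λ k → proj₁ (proj₂ (hit k))) , λ k →
      proj₁ (near k) , proj₁ (proj₂ (proj₂ (hit k))) , proj₂ (proj₂ (proj₂ (hit k))) ,
      proj₂ (near k)

Near-mono : ∀ {ε η y b} → ε ℚ.≤ η → Near ε y b → Near η y b
Near-mono ε≤η (p , p◂y , y▸p+ε , p◂b , b▸p+ε) =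
  p , p◂y , ▸-≤-trans y▸p+ε (ℚ.+-monoʳ-≤ p ε≤η) , p◂b , ▸-≤-trans b▸p+ε (ℚ.+-monoʳ-≤ p ε≤η)

1/1+-multiple : ∀ c {ε} → 0ℚ ℚ.< ε → ∃[ j ] fromℤ (+ suc c) ℚ.* 1/1+ j ℚ.≤ ε
1/1+-multiple c 0<ε =
  let η , 0<η , 1+c*η≡ε = fraction c 0<ε
      j , 1/1+j<η       = 1/1+-archimedean 0<η
  in j , subst (fromℤ (+ suc c) ℚ.* 1/1+ j ℚ.≤_) 1+c*η≡ε
    (ℚ.*-monoˡ-≤-nonNeg (fromℤ (+ suc c)) (ℚ.<⇒≤ 1/1+j<η))

-- A margin for three errors of at most 1/(j+1) each: those of the cells of `x` and `y`, and that of
-- `y` as an approximation of the limit `b`.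
3/1+ : ℕ → ℚ
3/1+ j = fromℤ (+ 3) ℚ.* 1/1+ j

3/1+-anti-≤ : ∀ {m n} → m ℕ.≤ n → 3/1+ n ℚ.≤ 3/1+ m
3/1+-anti-≤ m≤n = ℚ.*-monoˡ-≤-nonNeg (fromℤ (+ 3)) (1/1+-anti-≤ m≤n)

-- The sums of pairs in [s , t] × [s′ , t′] lie in the interval J index, 3/(margin+1) away from its
-- endpoints.
record Box (J : ℕ → OpenInterval) (b : ℝ) : Set where
  field
    index margin : ℕ
    s t s′ t′ u v : ℚ
    s′◂b  : s′ ◂ b
    b▸t′  : b ▸ t′
    l▸u   : left (J index) ▸ u
    v◂r   : v ◂ right (J index)
    u≤    : u ℚ.+ 3/1+ margin ℚ.≤ s ℚ.+ s′
    ≤v    : t ℚ.+ t′ ℚ.+ 3/1+ margin ℚ.≤ v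

module _ {J : ℕ → OpenInterval} {b : ℝ} where
  open Box

  around : ∀ x n → x + b ∈ ⟦ J n ⟧ → ∃[ i ] (s {J} {b} i ◂ x × x ▸ t i)
  around x n (l<x+b , x+b<r) =
    let u , l▸u , u◂x+b = between (left (J n)) (x + b) l<x+b
        v , x+b▸v , v◂r = between (x + b) (right (J n)) x+b<r
        s , s′ , s◂x , s′◂b , u<s+s′ = below-sum x b u◂x+b
        t , t′ , x▸t , b▸t′ , t+t′<v = above-sum x b x+b▸v
        i , 3/1+i≤ = 1/1+-multiple 2 (0<q-p u<s+s′)
        j , 3/1+j≤ = 1/1+-multiple 2 (0<q-p t+t′<v)
    in record
      -- The larger index gives the smaller margin, which fits at both ends.
      { index = n ; margin = i ℕ.⊔ j
      ; s = s ; t = t ; s′ = s′ ; t′ = t′ ; u = u ; v = v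
      ; s′◂b = s′◂b ; b▸t′ = b▸t′ ; l▸u = l▸u ; v◂r = v◂r
      ; u≤ = fits (ℚ.≤-trans (3/1+-anti-≤ (ℕ.m≤m⊔n i j)) 3/1+i≤)
      ; ≤v = fits (ℚ.≤-trans (3/1+-anti-≤ (ℕ.m≤n⊔m i j)) 3/1+j≤)
      } , s◂x , x▸t
    where
    fits : ∀ {p q ε} → ε ℚ.≤ q ℚ.- p → p ℚ.+ ε ℚ.≤ q
    fits {p} {q} {ε} ε≤q-p = linear-≤ ε≤q-p (lemma p q ε)
      where
      lemma : ∀ p q ε → q ℚ.- p ℚ.+ (p ℚ.+ ε) ≡ ε ℚ.+ q
      lemma = solve-∀ ℚ-ring

  -- One bound `C` serves two ends: only the intervals `J 0` to `J C` occur, and the margin is at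
  -- least 3/(C+1).
  Fits : ℕ → ℝ → Set
  Fits C x = ∃[ i ] (index {J} {b} i ℕ.≤ C × margin i ℕ.≤ C × s i ◂ x × x ▸ t i)

  Fits-mono : ∀ {C C′ x} → C ℕ.≤ C′ → Fits C x → Fits C′ x
  Fits-mono C≤C′ (i , index≤C , margin≤C , box) =
    i , ℕ.≤-trans index≤C C≤C′ , ℕ.≤-trans margin≤C C≤C′ , box

  -- The boxes around the points of `A` index an open cover of `A`, so finitely many suffice, and
  -- `C` is a bound for their indices and margins. It depends on `J` and `b` but on no scale.
  lebesgue-number : ∀ {A} → Compact A → (∀ {x} → x ∈ A → ∃[ n ] x + b ∈ ⟦ J n ⟧) →
    ∃[ C ] (∀ {x} → x ∈ A → Fits C x)
  lebesgue-number compact cover =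
    let is , finite = compact-ℚ compact s t
          (λ {x} x∈A → let n , x+b∈ = cover x∈A in around x n x+b∈)
        C , ≤C      = bounded (λ i → index i ℕ.⊔ margin i) is
    in C , λ x∈A → let i , i∈is , s◂x , x▸t = finite x∈A in
      i , ℕ.m⊔n≤o⇒m≤o (index i) (margin i) (≤C i∈is) ,
      ℕ.m⊔n≤o⇒n≤o (index i) (margin i) (≤C i∈is) , s◂x , x▸t

  module _ {δ : ℚ} (0<δ : 0ℚ ℚ.< δ) where
    open Grid δ 0<δ

    -- The point `grid (k + l)` is at most `x + y` and more than `x + y − 2δ`, and replacing `y` by
    -- `b` costs `ε`. The margin covers both errors.
    fits⇒grid-sum-∈ : ∀ {C ε x y k l} → Fits C x → Near ε y b → Cell k x → Cell l y →
      δ ℚ.+ δ ℚ.+ ε ℚ.≤ 3/1+ C →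
      ∃[ n ] (n ℕ.≤ C × left (J n) ▸ grid (k ℤ.+ l) × grid (k ℤ.+ l) ◂ right (J n))
    fits⇒grid-sum-∈ {C} {ε} {x} {y} {k} {l} (i , index≤C , margin≤C , s◂x , x▸t)
      (p , p◂y , y▸p+ε , p◂b , b▸p+ε) ck cl 2δ+ε≤ =
      index i , index≤C ,
      ▸-≤-trans (l▸u i) (linear-≤
        (ℚ.+-mono-≤ (ℚ.+-mono-≤ (ℚ.+-mono-≤ (ℚ.<⇒≤ s<) (ℚ.<⇒≤ p<)) (ℚ.<⇒≤ s′<))
          (ℚ.+-mono-≤ (u≤ i) 2δ+ε≤margin))
        (trans (lower-eq (grid k) (grid l) δ p ε (s i) (s′ i) (3/1+ (margin i)) (u i))
          (cong (s i ℚ.+ p ℚ.+ s′ i ℚ.+ (u i ℚ.+ 3/1+ (margin i) ℚ.+ (δ ℚ.+ δ ℚ.+ ε)) ℚ.+_)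
            (sym (grid-+ k l))))) ,
      -- On this side only `ε` is lost; the unspent `2δ` of the margin is discarded by the last
      -- summand, `0 < δ + δ`.
      ≤-◂-trans (linear-≤
        (ℚ.+-mono-≤ (ℚ.+-mono-≤ (ℚ.+-mono-≤ (ℚ.<⇒≤ (cell-< ck x▸t)) (ℚ.<⇒≤ (cell-< cl y▸p+ε)))
            (ℚ.<⇒≤ (◂-▸⇒< p◂b (b▸t′ i))))
          (ℚ.+-mono-≤ (ℚ.+-mono-≤ (≤v i) 2δ+ε≤margin) (ℚ.<⇒≤ (ℚ.+-mono-< 0<δ 0<δ))))
        (trans (cong (t i ℚ.+ (p ℚ.+ ε) ℚ.+ t′ i ℚ.+ (v i ℚ.+ 3/1+ (margin i) ℚ.+ (δ ℚ.+ δ)) ℚ.+_)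
            (grid-+ k l))
          (upper-eq (grid k) (grid l) δ p ε (t i) (t′ i) (3/1+ (margin i)) (v i)))) (v◂r i)
      where
      2δ+ε≤margin : δ ℚ.+ δ ℚ.+ ε ℚ.≤ 3/1+ (margin i)
      2δ+ε≤margin = ℚ.≤-trans 2δ+ε≤ (3/1+-anti-≤ margin≤C)
      s< : s i ℚ.< grid k ℚ.+ δ
      s< = subst (s i ℚ.<_) (grid-suc k) (◂-▸⇒< s◂x (below-right ck))
      p< : p ℚ.< grid l ℚ.+ δ
      p< = subst (p ℚ.<_) (grid-suc l) (◂-▸⇒< p◂y (below-right cl))
      s′< : s′ i ℚ.< p ℚ.+ ε
      s′< = ◂-▸⇒< (s′◂b i) b▸p+ε
      lower-eq : ∀ k l δ p ε s s′ m u →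
        k ℚ.+ δ ℚ.+ (l ℚ.+ δ) ℚ.+ (p ℚ.+ ε) ℚ.+ (s ℚ.+ s′ ℚ.+ m) ℚ.+ u ≡
        s ℚ.+ p ℚ.+ s′ ℚ.+ (u ℚ.+ m ℚ.+ (δ ℚ.+ δ ℚ.+ ε)) ℚ.+ (k ℚ.+ l)
      lower-eq = solve-∀ ℚ-ring
      upper-eq : ∀ k l δ p ε t t′ m v →
        t ℚ.+ (p ℚ.+ ε) ℚ.+ t′ ℚ.+ (v ℚ.+ m ℚ.+ (δ ℚ.+ δ)) ℚ.+ (k ℚ.+ l) ≡
        k ℚ.+ l ℚ.+ p ℚ.+ (t ℚ.+ t′ ℚ.+ m ℚ.+ (δ ℚ.+ δ ℚ.+ ε) ℚ.+ (0ℚ ℚ.+ 0ℚ)) ℚ.+ v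
      upper-eq = solve-∀ ℚ-ring

-- Grid points in a cover

module _ {δ : ℚ} (0<δ : 0ℚ ℚ.< δ) (em : ExcludedMiddle 0ℓ) where
  open Grid δ 0<δ

  Enclosure : OpenInterval → ℤ → ℕ → Set
  Enclosure J start width =
    (∀ {d} → left J ▸ grid d → grid d ◂ right J → start ℤ.≤ d × d ℤ.< start ℤ.+ + width) ×
    grid (+ width ℤ.- + 3) ◂ len J

  -- As `right J` exceeds `(g − 1)δ` and `left J` is below `(f + 1)δ`, the length exceeds
  -- `(g − f − 2)δ`. Against the `g + 1 − f` integers from `f` to `g` this is a loss of three.
  enclose-cells : ∀ J {f g} → Cell f (left J) → Cell g (right J) →
    Enclosure J f ℤ.∣ g ℤ.+ + 1 ℤ.- f ∣
  enclose-cells J {f} {g} cf cg =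
    (λ {d} l▸d d◂r → ℤ.<⇒≤ (grid-cancel-< (cell-< cf l▸d)) ,
      subst (d ℤ.<_) g+1≡f+∣w∣ (grid-cancel-< (◂-▸⇒< d◂r (below-right cg)))) ,
    subst (_◂ len J) width-eq
      (+-mono-◂ (cell-◂ cg (grid-mono-< (i-1<i g))) (neg-▸ (below-right cf)))
    where
    w = g ℤ.+ + 1 ℤ.- f

    f≤g+1 : f ℤ.≤ g ℤ.+ + 1
    f≤g+1 = ℤ.≮⇒≥ λ g+1<f →
      left≤right J (▸-◂⇒< (below-right cg) (cell-◂ cf (grid-mono-< g+1<f)))

    +∣w∣≡w : + ℤ.∣ w ∣ ≡ w
    +∣w∣≡w = ℤ.0≤i⇒+∣i∣≡i (ℤ.i≤j⇒0≤j-i f≤g+1)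

    g+1≡f+∣w∣ : g ℤ.+ + 1 ≡ f ℤ.+ + ℤ.∣ w ∣
    g+1≡f+∣w∣ = trans (lemma f g) (cong (λ i → f ℤ.+ i) (sym +∣w∣≡w))
      where
      lemma : ∀ f g → g ℤ.+ + 1 ≡ f ℤ.+ (g ℤ.+ + 1 ℤ.- f)
      lemma = ℤRing.solve-∀

    width-eq : grid (g ℤ.- + 1) ℚ.+ ℚ.- grid (f ℤ.+ + 1) ≡ grid (+ ℤ.∣ w ∣ ℤ.- + 3)
    width-eq = trans (cong (λ i → grid i ℚ.- grid (f ℤ.+ + 1)) (lemma f g))
      (trans (cong (ℚ._- grid (f ℤ.+ + 1)) (grid-+ (w ℤ.- + 3) (f ℤ.+ + 1)))
        (trans (cancel (grid (w ℤ.- + 3)) (grid (f ℤ.+ + 1)))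
          (cong (λ i → grid (i ℤ.- + 3)) (sym +∣w∣≡w))))
      where
      lemma : ∀ f g → g ℤ.- + 1 ≡ g ℤ.+ + 1 ℤ.- f ℤ.- + 3 ℤ.+ (f ℤ.+ + 1)
      lemma = ℤRing.solve-∀
      cancel : ∀ a b → a ℚ.+ b ℚ.- b ≡ a
      cancel = solve-∀ ℚ-ring

  abstract
    enclose : ∀ J → ∃[ f ] ∃[ w ] Enclosure J f w
    enclose J =
      let f , cf = floor em (left J)
          g , cg = floor em (right J)
      in f , _ , enclose-cells J cf cg

  module _ (J : ℕ → OpenInterval) where

    private
      start : ℕ → ℤ
      start n = proj₁ (enclose (J n))

      width : ℕ → ℕ
      width n = proj₁ (proj₂ (enclose (J n)))

      encloses : ∀ n {d} → left (J n) ▸ grid d → grid d ◂ right (J n) →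
        start n ℤ.≤ d × d ℤ.< start n ℤ.+ + width n
      encloses n = proj₁ (proj₂ (proj₂ (enclose (J n))))

      tight : ∀ n → grid (+ width n ℤ.- + 3) ◂ len (J n)
      tight n = proj₂ (proj₂ (proj₂ (enclose (J n))))

      points : ℕ → List ℤ
      points zero    = []
      points (suc n) = points n ++ map (λ i → start n ℤ.+ + i) (upTo (width n))

      ∈-points : ∀ {d n N} → n ℕ.< N → left (J n) ▸ grid d → grid d ◂ right (J n) → d ∈ˡ points N
      ∈-points {d} {n} {suc N} n<1+N l▸d d◂r with n ℕ.≟ N
      ... | no n≢N   = ∈ˡ.∈-++⁺ˡ (∈-points (ℕ.≤∧≢⇒< (ℕ.≤-pred n<1+N) n≢N) l▸d d◂r)
      ... | yes refl = ∈ˡ.∈-++⁺ʳ (points N) (subst (_∈ˡ _) offset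
        (∈ˡ.∈-map⁺ (λ i → start N ℤ.+ + i) (∈ˡ.∈-upTo⁺ (ℤ.drop‿+<+
          (subst₂ ℤ._<_ (sym +∣d-s∣≡d-s) (lemma′ (start N) (+ width N))
            (ℤ.+-monoˡ-< (ℤ.- start N) d<s+w))))))
        where
        s≤d = proj₁ (encloses N l▸d d◂r)
        d<s+w = proj₂ (encloses N l▸d d◂r)
        lemma : ∀ s d → d ≡ s ℤ.+ (d ℤ.- s)
        lemma = ℤRing.solve-∀
        lemma′ : ∀ s w → s ℤ.+ w ℤ.- s ≡ w
        lemma′ = ℤRing.solve-∀
        +∣d-s∣≡d-s : + ℤ.∣ d ℤ.- start N ∣ ≡ d ℤ.- start N
        +∣d-s∣≡d-s = ℤ.0≤i⇒+∣i∣≡i (ℤ.i≤j⇒0≤j-i s≤d)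
        offset : start N ℤ.+ + ℤ.∣ d ℤ.- start N ∣ ≡ d
        offset = trans (cong (λ i → start N ℤ.+ i) +∣d-s∣≡d-s) (sym (lemma (start N) d))

      excess : ℕ → ℤ
      -- The initial value -1 makes the strict bound `excess-◂` true of the empty sum, which is 0.
      excess zero    = -[1+ 0 ]
      excess (suc n) = excess n ℤ.+ (+ width n ℤ.- + 3)

      excess-◂ : ∀ n → grid (excess n) ◂ partialSum (λ i → len (J i)) n
      excess-◂ zero    = fromℚ-mono-◂ (subst (grid -[1+ 0 ] ℚ.<_) grid-0 (grid-mono-< ℤ.-<+))
      excess-◂ (suc n) = subst (_◂ partialSum (λ i → len (J i)) (suc n)) (sym (grid-+ _ _))
        (+-mono-◂ (excess-◂ n) (tight n))

      length-points : ∀ n → + length (points n) ≡ excess n ℤ.+ (+ 1 ℤ.+ + 3 ℤ.* + n)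
      length-points zero    = refl
      length-points (suc n) = trans
        (cong +_ (trans (List.length-++ (points n))
          (cong (length (points n) ℕ.+_)
            (trans (List.length-map _ (upTo (width n))) (List.length-upTo (width n))))))
        (trans (ℤ.pos-+ (length (points n)) (width n))
          (trans (cong (ℤ._+ + width n) (length-points n))
            (trans (lemma (excess n) (+ width n) (+ n))
              (cong (λ i → excess n ℤ.+ (+ width n ℤ.- + 3) ℤ.+ (+ 1 ℤ.+ + 3 ℤ.* i))
                (sym (ℤ.pos-+ 1 n))))))
        where
        lemma : ∀ e w n → e ℤ.+ (+ 1 ℤ.+ + 3 ℤ.* n) ℤ.+ w ≡
          e ℤ.+ (w ℤ.- + 3) ℤ.+ (+ 1 ℤ.+ + 3 ℤ.* (+ 1 ℤ.+ n))
        lemma = ℤRing.solve-∀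

    -- The first `N` enclosures contain `D` and have `excess N + 1 + 3N` points, counted with
    -- multiplicity. Here `grid (excess N)` is less than a partial sum of the lengths, hence at most
    -- `r`.
    count-≤ : ∀ {r N D} → TotalLength J ≤ fromℚ r → Unique D →
      (∀ {d} → d ∈ˡ D → ∃[ n ] (n ℕ.< N × left (J n) ▸ grid d × grid d ◂ right (J n))) →
      grid (+ length D) ℚ.≤ r ℚ.+ grid (+ 1 ℤ.+ + 3 ℤ.* + N)
    count-≤ {r} {N} {D} total unique hit = ℚ.≤-trans
      (grid-mono-≤ (ℤ.≤-trans
        (ℤ.+≤+ (length-≤-⊆ unique λ d∈D →
          let n , n<N , l▸d , d◂r = hit d∈D in ∈-points n<N l▸d d◂r))
        (ℤ.≤-reflexive (length-points N))))
      (ℚ.≤-trans (ℚ.≤-reflexive (grid-+ (excess N) (+ 1 ℤ.+ + 3 ℤ.* + N)))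
        (ℚ.+-monoˡ-≤ _ (ℚ.≮⇒≥ λ (r<excess : r ℚ.< grid (excess N)) →
          total N (_◂_.lower⁻¹ (≤-◂-trans (ℚ.<⇒≤ r<excess) (excess-◂ N))))))

-- Passage to the limit

module _ (B : Pred ℝ 0ℓ) where

  CommonSubsequence : ∀ {m} → (Fin m → ℕ → ℝ) → Set
  CommonSubsequence {m} y = ∃ λ (b : Fin m → ℝ) → (∀ i → b i ∈ B) ×
    ∃ λ (φ : ℕ → ℕ) → (∀ k → k ℕ.≤ φ k) × (∀ i k → Near (1/1+ k) (y i (φ k)) (b i))

  -- The subsequence `φ` chosen for the first sequence is refined by `ψ`. As `k ≤ ψ k`, its window
  -- of length 1/(ψ k + 1) is fine enough for `k`; this is why `k ≤ φ k` is carried along.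
  extend : ∀ {m} (y : Fin (suc m) → ℕ → ℝ) {b₀ : ℝ} {φ : ℕ → ℕ} → b₀ ∈ B → (∀ k → k ℕ.≤ φ k) →
    (∀ k → Near (1/1+ k) (y zero (φ k)) b₀) → CommonSubsequence (λ i n → y (suc i) (φ n)) →
    CommonSubsequence y
  extend {m} y {b₀} {φ} b₀∈B k≤φk near₀ (b , b∈B , ψ , k≤ψk , near) =
    b′ , b′∈B , (λ k → φ (ψ k)) , (λ k → ℕ.≤-trans (k≤ψk k) (k≤φk (ψ k))) , near′
    where
    b′ : Fin (suc m) → ℝ
    b′ zero    = b₀
    b′ (suc i) = b i
    b′∈B : ∀ i → b′ i ∈ B
    b′∈B zero    = b₀∈B
    b′∈B (suc i) = b∈B i
    near′ : ∀ i k → Near (1/1+ k) (y i (φ (ψ k))) (b′ i)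
    near′ zero    k = Near-mono (1/1+-anti-≤ (k≤ψk k)) (near₀ (ψ k))
    near′ (suc i) k = near i k

  common-subsequence : ExcludedMiddle 0ℓ → Compact B → ∀ {m} (y : Fin m → ℕ → ℝ) →
    (∀ i n → y i n ∈ B) → CommonSubsequence y
  common-subsequence em compact {zero} y y∈B = (λ ()) , (λ ()) , id , (λ _ → ℕ.≤-refl) , λ ()
  common-subsequence em compact {suc m} y y∈B =
    let b₀ , b₀∈B , φ , k≤φk , near₀ = convergent-subsequence em {B} compact (y zero) (y∈B zero)
    in extend y b₀∈B k≤φk near₀
         (common-subsequence em compact (λ i n → y (suc i) (φ n)) (λ i n → y∈B (suc i) (φ n)))

-- Cell counts at a single scale

module _ (em : ExcludedMiddle 0ℓ) {A B : Pred ℝ 0ℓ} (compactA : Compact A) (compactB : Compact B)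
  (nonemptyB : Satisfiable B) {δ : ℚ} (0<δ : 0ℚ ℚ.< δ) where
  open Grid δ 0<δ

  private
    module A = Discretisation (discretise em compactA)
    module B = Discretisation (discretise em compactB)

    -- The inequality of measures does not compare numbers of cells, and `discrete` wants at most
    -- one more cell for `B` than for `A`; so the surplus is cut off. `B-count` makes up for it.
    B′ : List ℤ
    B′ = take (suc (length A.cells)) B.cells

    B′⊆B : ∀ {l} → l ∈ˡ B′ → l ∈ˡ B.cells
    B′⊆B = All.lookup (All.take⁺ (suc (length A.cells)) (All.tabulate id))

    |B′| : length B′ ≡ suc (length A.cells) ℕ.⊓ length B.cells
    |B′| = List.length-take (suc (length A.cells)) B.cells

    B′-nonempty : ∃[ l ] l ∈ˡ B′
    B′-nonempty = nonempty (proj₁ (proj₂ (B.covers (proj₂ nonemptyB))))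
      where
      nonempty : ∀ {n} {ls : List ℤ} {l} → l ∈ˡ ls → ∃[ l ] l ∈ˡ take (suc n) ls
      nonempty {ls = l ∷ _} _ = l , here refl

  SumCell : (Fin 3 → ℝ) → ℤ → Set
  SumCell y d = ∃[ i ] ∃[ x ] ∃[ k ] ∃[ l ] (x ∈ A × Cell k x × Cell l (y i) × d ≡ k ℤ.+ l)

  DiscreteSum : (Fin 3 → ℝ) → Set
  DiscreteSum y = ∃[ D ] (Unique D × (∀ {d} → d ∈ˡ D → SumCell y d) ×
    length A.cells ℕ.+ length B′ ℕ.≤ suc (length D))

  discrete-sum : ∃[ y ] ((∀ i → y i ∈ B) × DiscreteSum y)
  discrete-sum =
    let b₁ , b₂ , b₃ , D , b₁∈ , b₂∈ , b₃∈ , uniqueD , sums , |D| =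
          discrete em A.unique (Unique.take⁺ (suc (length A.cells)) B.unique) (proj₂ B′-nonempty)
            (subst (ℕ._≤ suc (length A.cells)) (sym |B′|) (ℕ.m⊓n≤m _ _))
        y₁ , y₁∈B , c₁ = B.occupied (B′⊆B b₁∈)
        y₂ , y₂∈B , c₂ = B.occupied (B′⊆B b₂∈)
        y₃ , y₃∈B , c₃ = B.occupied (B′⊆B b₃∈)
    in (λ { zero → y₁ ; (suc zero) → y₂ ; (suc (suc zero)) → y₃ }) ,
       (λ { zero → y₁∈B ; (suc zero) → y₂∈B ; (suc (suc zero)) → y₃∈B }) ,
       D , uniqueD ,
       (λ d∈D → let k , k∈A , eq = sums d∈D ; x , x∈A , ck = A.occupied k∈A in
         [ (λ eq → zero , x , k , b₁ , x∈A , ck , c₁ , eq) ,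
         [ (λ eq → suc zero , x , k , b₂ , x∈A , ck , c₂ , eq) ,
           (λ eq → suc (suc zero) , x , k , b₃ , x∈A , ck , c₃ , eq) ]′ ]′ eq) ,
       |D|

  A-count : grid (+ suc (length A.cells)) ∈ above (μ A)
  A-count = discretisation-∈-μ 0<δ (discretise em compactA)

  -- Where truncation of B to B′ loses cells, the cells of A bound |B| because |B| ≤ |A|.
  B-count : μ B ≤∞ μ A → ∃[ n ] (grid (+ n) ∈ above (μ B) × n ℕ.≤ suc (length B′))
  B-count μB≤μA = choose (ℕ.≤-total (length B.cells) (suc (length A.cells)))
    where
    choose : length B.cells ℕ.≤ suc (length A.cells) ⊎ suc (length A.cells) ℕ.≤ length B.cells →
      ∃[ n ] (grid (+ n) ∈ above (μ B) × n ℕ.≤ suc (length B′))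
    choose (inj₁ b≤1+a) = suc (length B.cells) , discretisation-∈-μ 0<δ (discretise em compactB) ,
      s≤s (ℕ.≤-reflexive (sym (trans |B′| (ℕ.m≥n⇒m⊓n≡n b≤1+a))))
    choose (inj₂ 1+a≤b) = suc (length A.cells) , μB≤μA {grid (+ suc (length A.cells))} A-count ,
      ℕ.≤-trans (ℕ.≤-reflexive (sym (trans |B′| (ℕ.m≤n⇒m⊓n≡m 1+a≤b)))) (ℕ.n≤1+n (length B′))

  -- The rounding errors add up to a fixed number of cells: three from `bound` and `1 + 3(C + 1)`
  -- from enclosing the `C + 1` intervals that occur. With `C` fixed, the error tends to 0 with `δ`.
  at-scale : μ B ≤∞ μ A → ∀ {J r C} {b y : Fin 3 → ℝ} {ε} → TotalLength J ≤ fromℚ r →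
    (∀ i {x} → x ∈ A → Fits {J} {b i} C x) → DiscreteSum y → (∀ i → Near ε (y i) (b i)) →
    δ ℚ.+ δ ℚ.+ ε ℚ.≤ 3/1+ C →
    ∃[ p ] ∃[ q ] (p ∈ above (μ A) × q ∈ above (μ B) ×
      p ℚ.+ q ℚ.≤ r ℚ.+ fromℤ (+ (4 ℕ.+ 3 ℕ.* suc C)) ℚ.* δ)
  at-scale μB≤μA {J} {r} {C} total fits (D , uniqueD , sums , |D|) near 2δ+ε≤ =
    let n , n∈ , n≤ = B-count μB≤μA
    in grid (+ m) , grid (+ n) , A-count , n∈ , (begin
      grid (+ m) ℚ.+ grid (+ n)          ≡⟨ sym (grid-+ (+ m) (+ n)) ⟩
      grid (+ m ℤ.+ + n)                 ≤⟨ grid-mono-≤ (ℤ.+≤+ (bound n≤)) ⟩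
      grid (+ length D ℤ.+ + 3)          ≡⟨ grid-+ (+ length D) (+ 3) ⟩
      grid (+ length D) ℚ.+ grid (+ 3)   ≤⟨ ℚ.+-monoˡ-≤ (grid (+ 3)) count ⟩
      r ℚ.+ grid (+ 1 ℤ.+ + 3 ℤ.* + suc C) ℚ.+ grid (+ 3)
        ≡⟨ ℚ.+-assoc r (grid (+ 1 ℤ.+ + 3 ℤ.* + suc C)) (grid (+ 3)) ⟩
      r ℚ.+ (grid (+ 1 ℤ.+ + 3 ℤ.* + suc C) ℚ.+ grid (+ 3))
        ≡⟨ cong (r ℚ.+_) (sym (grid-+ (+ 1 ℤ.+ + 3 ℤ.* + suc C) (+ 3))) ⟩
      r ℚ.+ grid (+ 1 ℤ.+ + 3 ℤ.* + suc C ℤ.+ + 3)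
        ≡⟨ cong (λ c → r ℚ.+ grid c) constant ⟩
      r ℚ.+ grid (+ (4 ℕ.+ 3 ℕ.* suc C))
        ≡⟨ cong (r ℚ.+_) (grid-def (+ (4 ℕ.+ 3 ℕ.* suc C))) ⟩
      r ℚ.+ fromℤ (+ (4 ℕ.+ 3 ℕ.* suc C)) ℚ.* δ ∎)
    where
    m : ℕ
    m = suc (length A.cells)
    bound : ∀ {n} → n ℕ.≤ suc (length B′) → m ℕ.+ n ℕ.≤ length D ℕ.+ 3
    -- The three extra cells: one each for the successors in `m` and in the bound on `n`, and one
    -- lost in the discrete inequality.
    bound {n} n≤ = begin
      m ℕ.+ n                                ≤⟨ ℕ.+-monoʳ-≤ m n≤ ⟩
      m ℕ.+ suc (length B′)                  ≡⟨ cong suc (ℕ.+-suc (length A.cells) (length B′)) ⟩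
      2 ℕ.+ (length A.cells ℕ.+ length B′)   ≤⟨ ℕ.+-monoʳ-≤ 2 |D| ⟩
      3 ℕ.+ length D                         ≡⟨ ℕ.+-comm 3 (length D) ⟩
      length D ℕ.+ 3                         ∎
      where open ℕ.≤-Reasoning
    open ℚ.≤-Reasoning
    count : grid (+ length D) ℚ.≤ r ℚ.+ grid (+ 1 ℤ.+ + 3 ℤ.* + suc C)
    count = count-≤ 0<δ em J {r} {suc C} total uniqueD λ d∈D →
      let i , x , k , l , x∈A , ck , cl , d≡k+l = sums d∈D
          n , n≤C , l▸ , ◂r = fits⇒grid-sum-∈ 0<δ (fits i x∈A) (near i) ck cl 2δ+ε≤
      in n , s≤s n≤C , subst (λ d → left (J n) ▸ grid d) (sym d≡k+l) l▸ ,
         subst (λ d → grid d ◂ right (J n)) (sym d≡k+l) ◂r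
    constant : + 1 ℤ.+ + 3 ℤ.* + suc C ℤ.+ + 3 ≡ + (4 ℕ.+ 3 ℕ.* suc C)
    constant = trans (lemma (+ 3 ℤ.* + suc C))
      (cong (λ c → + 4 ℤ.+ c) (sym (ℤ.pos-* 3 (suc C))))
      where
      lemma : ∀ c → + 1 ℤ.+ c ℤ.+ + 3 ≡ + 4 ℤ.+ c
      lemma = ℤRing.solve-∀

three-copies : ∀ c → c ℚ.+ c ℚ.+ c ≡ fromℤ (+ 3) ℚ.* c
three-copies c = trans (lemma c) (cong (ℚ._* c) (sym 3≡))
  where
  lemma : ∀ c → c ℚ.+ c ℚ.+ c ≡ (1ℚ ℚ.+ (1ℚ ℚ.+ (1ℚ ℚ.+ 0ℚ))) ℚ.* c
  lemma = solve-∀ ℚ-ring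
  3≡ : fromℤ (+ 3) ≡ 1ℚ ℚ.+ (1ℚ ℚ.+ (1ℚ ℚ.+ 0ℚ))
  3≡ = refl

-- Letting the scale tend to zero

module _ (em : ExcludedMiddle 0ℓ) {A B : Pred ℝ 0ℓ} (compactA : Compact A) (compactB : Compact B)
  (nonemptyB : Satisfiable B) where

  private
    Sum : ℕ → (Fin 3 → ℝ) → Set
    Sum n = DiscreteSum em compactA compactB nonemptyB (0<1/1+ n)

    -- What is kept of the subsequence: arbitrarily fine scales whose discrete solutions `y` are
    -- close to `b`.
    Limit : (Fin 3 → ℝ) → Set
    Limit b = ∀ k → ∃[ n ] (k ℕ.≤ n × ∃[ y ] (Sum n y × (∀ i → Near (1/1+ k) (y i) (b i))))

  limit-translates : ∃[ b ] ((∀ i → b i ∈ B) × Limit b)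
  limit-translates =
    let scale n = discrete-sum em compactA compactB nonemptyB (0<1/1+ n)
        b , b∈B , φ , k≤φk , near = common-subsequence B em compactB
          (λ i n → proj₁ (scale n) i) (λ i n → proj₁ (proj₂ (scale n)) i)
    in b , b∈B , λ k →
      φ k , k≤φk k , proj₁ (scale (φ k)) , proj₂ (proj₂ (scale (φ k))) , λ i → near i k

  -- The order of choices matters. A cover of total length at most `r < q` fixes `C`, a common bound
  -- for the three translates; then `j` makes the error of `at-scale` at most `q − r`; only then is
  -- a scale beyond both taken from `Limit`.
  limit-large : μ B ≤∞ μ A → ∀ {b} → Limit b →
    (μ A +∞ μ B) ≤∞ μ (A ⊕ ｛ b zero , b (suc zero) , b (suc (suc zero)) ｝)
  limit-large μB≤μA {b} limit {q} (J , cover , r , r<q , total) =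
    let C , ≤C            = bounded (λ i → proj₁ (lebesgue i)) (allFin 3)
        -- `1/1+-multiple c` concerns the multiple `c + 1`, so this 3 becomes the 4 of `at-scale`.
        j , small         = 1/1+-multiple (3 ℕ.+ 3 ℕ.* suc C) (0<q-p r<q)
        n , k≤n , y , sum , near = limit (C ℕ.⊔ j)
        p , p′ , p∈ , p′∈ , p+p′≤ = at-scale em compactA compactB nonemptyB (0<1/1+ n) μB≤μA
          {r = r} {b = b} total
          (λ i x∈A → Fits-mono (≤C (∈ˡ.∈-allFin i)) (proj₂ (lebesgue i) x∈A)) sum near
          (small-scale (ℕ.≤-trans (ℕ.m≤m⊔n C j) k≤n) (ℕ.m≤m⊔n C j))
    in p , p′ , p∈ , p′∈ , ℚ.≤-trans p+p′≤ (ℚ.≤-trans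
         (ℚ.+-monoʳ-≤ r (ℚ.≤-trans (ℚ.*-monoˡ-≤-nonNeg (fromℤ (+ (4 ℕ.+ 3 ℕ.* suc C)))
           (1/1+-anti-≤ (ℕ.≤-trans (ℕ.m≤n⊔m C j) k≤n))) small))
         (ℚ.≤-reflexive (lemma r q)))
    where
    lemma : ∀ r q → r ℚ.+ (q ℚ.- r) ≡ q
    lemma = solve-∀ ℚ-ring

    member : ∀ i → b i ∈ ｛ b zero , b (suc zero) , b (suc (suc zero)) ｝
    member zero             = inj₁ (≃-refl (b zero))
    member (suc zero)       = inj₂ (inj₁ (≃-refl (b (suc zero))))
    member (suc (suc zero)) = inj₂ (inj₂ (≃-refl (b (suc (suc zero)))))

    lebesgue : ∀ i → ∃[ C ] (∀ {x} → x ∈ A → Fits {J} {b i} C x)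
    lebesgue i = lebesgue-number {J} {b i} compactA
      λ {x} x∈A → cover {x + b i} (x , b i , x∈A , member i , ≃-refl (x + b i))

    small-scale : ∀ {C n k} → C ℕ.≤ n → C ℕ.≤ k → 1/1+ n ℚ.+ 1/1+ n ℚ.+ 1/1+ k ℚ.≤ 3/1+ C
    small-scale {C} C≤n C≤k =
      ℚ.≤-trans (ℚ.+-mono-≤ (ℚ.+-mono-≤ (1/1+-anti-≤ C≤n) (1/1+-anti-≤ C≤n)) (1/1+-anti-≤ C≤k))
        (ℚ.≤-reflexive (three-copies (1/1+ C)))

corollary10 : ExcludedMiddle 0ℓ →
    (A B : Pred ℝ 0ℓ) → A Respects _≃_ → B Respects _≃_ →
    Satisfiable A → Satisfiable B → Compact A → Compact B →
    μ B ≤∞ μ A →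
    ∃[ b₁ ] ∃[ b₂ ] ∃[ b₃ ] (b₁ ∈ B × b₂ ∈ B × b₃ ∈ B ×
    (μ A +∞ μ B) ≤∞ μ (A ⊕ ｛ b₁ , b₂ , b₃ ｝))
corollary10 em A B _ _ _ nonemptyB compactA compactB μB≤μA =
  let b , b∈B , limit = limit-translates em compactA compactB nonemptyB
  in b zero , b (suc zero) , b (suc (suc zero)) , b∈B zero , b∈B (suc zero) , b∈B (suc (suc zero)) ,
     limit-large em compactA compactB nonemptyB μB≤μA limit
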